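{- \[\sum_{n\ge0}p_n(1123,1211)t^n=\frac{(1-t^2)\sqrt{(1-t)(1-t-4t^2)}}{2t^2(1-3t+t^2)}-\frac{1-3t-2t^2+14t^3-15t^4+3t^5}{2t^2(1-t)^2(1-3t+t^2)}.\]
   Context: Set partitions of $[n]$ are written in canonical sequential form (restricted growth words $\pi_1\cdots\pi_n$ with $\pi_1=1$, $\pi_{i+1}\le\max(\pi_1,\dots,\pi_i)+1$). A partition contains a pattern if it has a subsequence order-isomorphic to it; $p_n(T)$ counts partitions of $[n]$ avoiding every pattern in $T$ (with $p_0=1$). The square root is the branch that is a power series with constant term $1$. -}

module Defs where

open import Agda.Builtin.FromNat using (Number; fromNat) public
open import Data.Bool.Base using (if_then_else_; true; false)
open import Data.Fin.Base as Fin using (Fin; zero; suc; toℕ; fromℕ; fromℕ<; inject₁; punchIn; cast)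
open import Data.Fin.Properties as Finₚ using (toℕ<n; toℕ-fromℕ; toℕ-fromℕ<; toℕ-inject₁; toℕ-injective; punchInᵢ≢i)
open import Data.Integer.Base using (+_)
open import Data.List.Base using (List; []; _∷_; length; lookup; map; concatMap; applyUpTo; filter)
open import Data.List.Membership.Propositional using (_∈_; find; lose)
open import Data.List.Membership.Propositional.Properties using (∈-map⁺; ∈-map⁻; ∈-concatMap⁺; ∈-concatMap⁻; ∈-applyUpTo⁺; ∈-applyUpTo⁻)
open import Data.List.Properties using (∷-injectiveˡ; ∷-injectiveʳ)
open import Data.List.Relation.Binary.Sublist.Propositional using (_⊆_; []; _∷_; _∷ʳ_)
open import Data.List.Relation.Unary.All as All using (All; all?)
import Data.List.Relation.Unary.All.Properties as Allₚ
import Data.List.Relation.Unary.AllPairs as AllPairs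
import Data.List.Relation.Unary.AllPairs.Properties as AllPairsₚ
open import Data.List.Relation.Unary.Any using (here; there)
open import Data.List.Relation.Unary.Unique.Propositional using (Unique)
import Data.List.Relation.Unary.Unique.Propositional.Properties as Uniqueₚ
open import Data.Nat.Base as ℕ using (ℕ; zero; suc; _∸_; _⊔_; z≤n; s≤s)
import Data.Nat.Literals as ℕ
import Data.Nat.Properties as ℕ
open import Data.Product.Base using (∃; _×_; _,_; proj₁; proj₂)
open import Data.Rational.Base as ℚ using (ℚ; 0ℚ; 1ℚ; ½)
open import Data.Rational.Literals using (fromℤ)
import Data.Rational.Properties as ℚ
open import Data.Sum.Base using (_⊎_; inj₁; inj₂)
open import Data.Unit.Base using (⊤; tt) public
open import Data.Vec.Functional using (removeAt)
open import Function.Base using (_∘_; case_of_)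
open import Function.Bundles using (_⇔_; mk⇔; module Equivalence)
open import Relation.Binary.Definitions using (tri<; tri≈; tri>)
open import Relation.Binary.PropositionalEquality
open import Relation.Nullary.Decidable using (Dec; yes; no; ¬?; _×-dec_; _→-dec_; map′)
open import Relation.Nullary.Negation using (¬_; contradiction)
open import Relation.Unary using (Decidable)

open import Algebra.Bundles using (CommutativeRing)
open import Algebra.Properties.CommutativeMonoid.Sum (CommutativeRing.+-commutativeMonoid ℚ.+-*-commutativeRing) using (sum; sum-remove; sum-init-last; sum-cong-≗; sum-replicate-zero)

instance
  number-ℕ : Number ℕ
  number-ℕ = ℕ.number

-- Canonical m w: w can continue a canonical word whose largest letter is m.
-- As the largest letter of the empty word is taken to be 0, the first letter
-- of a word w with Canonical 0 w is forced to be 1.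

data Canonical (m : ℕ) : List ℕ → Set where
  []   : Canonical m []
  step : ∀ {x w} → 1 ℕ.≤ x → x ℕ.≤ suc m → Canonical (m ⊔ x) w → Canonical m (x ∷ w)

continuations : (m n : ℕ) → List (List ℕ)
continuations m zero    = [] ∷ []
continuations m (suc n) = concatMap (λ x → map (x ∷_) (continuations (m ⊔ x) n)) (applyUpTo suc (suc m))

partitions : ℕ → List (List ℕ)
partitions = continuations 0

continuations-complete : ∀ {m w} → Canonical m w → w ∈ continuations m (length w)
continuations-complete []                                   = here refl
continuations-complete {m} (step {suc x} _ (s≤s x≤m) w-can) =
  ∈-concatMap⁺ _ (lose (∈-applyUpTo⁺ suc (s≤s x≤m)) (∈-map⁺ _ (continuations-complete w-can)))

continuations-sound : ∀ m n {w} → w ∈ continuations m n → length w ≡ n × Canonical m w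
continuations-sound m zero    (here refl) = refl , []
continuations-sound m (suc n) w∈
  with find (∈-concatMap⁻ _ {xs = applyUpTo suc (suc m)} w∈)
... | _ , x∈ , w∈map with ∈-applyUpTo⁻ suc x∈ | ∈-map⁻ _ w∈map
... | i , s≤s i≤m , refl | v , v∈ , refl with continuations-sound (m ⊔ suc i) n v∈
... | len , v-can = cong suc len , step (s≤s z≤n) (s≤s i≤m) v-can

∈-partitions : ∀ {n w} → w ∈ partitions n ⇔ (length w ≡ n × Canonical 0 w)
∈-partitions {n} = mk⇔ (continuations-sound 0 n) (λ { (refl , w-can) → continuations-complete w-can })

continuations-unique : ∀ m n → Unique (continuations m n)
continuations-unique m zero    = All.[] AllPairs.∷ AllPairs.[]
continuations-unique m (suc n) = Uniqueₚ.concat⁺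
  (Allₚ.map⁺ (All.universal (λ x → Uniqueₚ.map⁺ ∷-injectiveʳ (continuations-unique (m ⊔ x) n)) _))
  (AllPairsₚ.map⁺ (AllPairs.map disjoint
    (Uniqueₚ.applyUpTo⁺₁ suc (suc m) (λ i<j _ eq → ℕ.<⇒≢ i<j (ℕ.suc-injective eq)))))
  where
  disjoint : ∀ {x y} → x ≢ y → ∀ {w} →
             ¬ (w ∈ map (x ∷_) (continuations (m ⊔ x) n) × w ∈ map (y ∷_) (continuations (m ⊔ y) n))
  disjoint x≢y (p , q) with ∈-map⁻ _ p | ∈-map⁻ _ q
  ... | _ , _ , refl | _ , _ , eq = x≢y (∷-injectiveˡ eq)

partitions-unique : ∀ n → Unique (partitions n)
partitions-unique = continuations-unique 0

-- The comparisons of i with j and of j with i together also make equal letters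
-- correspond to equal letters.

OrderIsomorphic : List ℕ → List ℕ → Set
OrderIsomorphic u v = ∃ λ (eq : length u ≡ length v) → ∀ i j →
  (lookup u i ℕ.< lookup u j) ⇔ (lookup v (cast eq i) ℕ.< lookup v (cast eq j))

Contains : List ℕ → List ℕ → Set
Contains w τ = ∃ λ v → v ⊆ w × OrderIsomorphic v τ

Avoids : List (List ℕ) → List ℕ → Set
Avoids T w = All (λ τ → ¬ Contains w τ) T

_⇔?_ : ∀ {A B : Set} → Dec A → Dec B → Dec (A ⇔ B)
A? ⇔? B? = map′ (λ (f , g) → mk⇔ f g) (λ e → Equivalence.to e , Equivalence.from e)
                ((A? →-dec B?) ×-dec (B? →-dec A?))

orderIsomorphic? : ∀ u v → Dec (OrderIsomorphic u v)
orderIsomorphic? u v with length u ℕ.≟ length v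
... | no  neq = no (neq ∘ proj₁)
... | yes eq  = map′ (eq ,_) proj₂ (Finₚ.all? λ i → Finₚ.all? λ j →
  (lookup u i ℕ.<? lookup u j) ⇔? (lookup v (cast eq i) ℕ.<? lookup v (cast eq j)))

sublist? : ∀ {P : List ℕ → Set} → Decidable P → ∀ w → Dec (∃ λ v → v ⊆ w × P v)
sublist? P? [] = map′ (λ p → [] , [] , p) (λ { (_ , [] , p) → p }) (P? [])
sublist? P? (x ∷ w) with sublist? (P? ∘ (x ∷_)) w | sublist? P? w
... | yes (v , v⊆w , p) | _                 = yes (x ∷ v , refl ∷ v⊆w , p)
... | no _              | yes (v , v⊆w , p) = yes (v , x ∷ʳ v⊆w , p)
... | no ¬with          | no ¬without       = no λ where
  (_ , refl ∷ v⊆w , p) → ¬with (_ , v⊆w , p)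
  (_ , _ ∷ʳ v⊆w , p)   → ¬without (_ , v⊆w , p)

contains? : ∀ w τ → Dec (Contains w τ)
contains? w τ = sublist? (λ v → orderIsomorphic? v τ) w

avoids? : ∀ T → Decidable (Avoids T)
avoids? T w = all? (λ τ → ¬? (contains? w τ)) T

p : ℕ → List (List ℕ) → ℕ
p n T = length (filter (avoids? T) (partitions n))

Series : Set
Series = ℕ → ℚ

infixl 6 _+_ _-_
infixl 7 _*_
infixr 8 _^_

_+_ _-_ _*_ : Series → Series → Series
(f + g) n = f n ℚ.+ g n
(f - g) n = f n ℚ.- g n
(f * g) n = sum {suc n} (λ i → f (toℕ i) ℚ.* g (n ∸ toℕ i))

constant : ℚ → Series
constant c zero    = c
constant c (suc _) = 0ℚ

t : Series
t 1 = 1ℚ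
t _ = 0ℚ

_^_ : Series → ℕ → Series
f ^ zero  = constant 1ℚ
f ^ suc k = f * f ^ k

instance
  number-Series : Number Series
  number-Series = record { Constraint = λ _ → ⊤ ; fromNat = λ n → constant (fromℤ (+ n)) }

generatingFunction : (ℕ → ℕ) → Series
generatingFunction a n = fromℤ (+ a n)

-- For s² = f with s₀ = 1, comparing coefficients of t¹⁺ⁿ gives
--   2 s₁₊ₙ + Σ_{i<n} s₁₊ᵢ sₙ₋ᵢ = f₁₊ₙ.
-- sqrtUpTo f n is correct in degrees ≤ n; its further values are irrelevant.

sqrtUpTo : Series → ℕ → Series
sqrtUpTo f zero    _ = 1ℚ
sqrtUpTo f (suc n) k =
  if k ℕ.≤ᵇ n then s k
  else (f (suc n) ℚ.- sum {n} (λ i → s (suc (toℕ i)) ℚ.* s (n ∸ toℕ i))) ℚ.* ½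
  where s = sqrtUpTo f n

-- Meaningful for f with constant term 1; see √-square.

√ : Series → Series
√ f n = sqrtUpTo f n n

sqrtUpTo-suc-≤ : ∀ f {n k} → k ℕ.≤ n → sqrtUpTo f (suc n) k ≡ sqrtUpTo f n k
sqrtUpTo-suc-≤ f {n} {k} k≤n with k ℕ.≤ᵇ n | ℕ.≤⇒≤ᵇ k≤n
... | true | _ = refl

sqrtUpTo-stable : ∀ f {n k} → k ℕ.≤′ n → sqrtUpTo f n k ≡ √ f k
sqrtUpTo-stable f (ℕ.≤′-reflexive refl) = refl
sqrtUpTo-stable f (ℕ.≤′-step k≤n)       =
  trans (sqrtUpTo-suc-≤ f (ℕ.≤′⇒≤ k≤n)) (sqrtUpTo-stable f k≤n)

√-suc : ∀ f n → √ f (suc n) ≡ (f (suc n) ℚ.- sum {n} (λ i → √ f (suc (toℕ i)) ℚ.* √ f (n ∸ toℕ i))) ℚ.* ½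
√-suc f n with suc n ℕ.≤ᵇ n | ℕ.≤ᵇ⇒≤ (suc n) n
... | true  | ≤ = contradiction (≤ tt) (ℕ.<-irrefl refl)
... | false | _ = cong (λ x → (f (suc n) ℚ.- x) ℚ.* ½) (sum-cong-≗ {n} λ i → cong₂ ℚ._*_
  (sqrtUpTo-stable f (ℕ.≤⇒≤′ (toℕ<n i)))
  (sqrtUpTo-stable f (ℕ.≤⇒≤′ (ℕ.m∸n≤m n (toℕ i)))))

√-constantTerm : ∀ f → √ f 0 ≡ 1ℚ
√-constantTerm f = refl

private
  halves : ∀ x y → 1ℚ ℚ.* ((x ℚ.- y) ℚ.* ½) ℚ.+ (y ℚ.+ ((x ℚ.- y) ℚ.* ½) ℚ.* 1ℚ) ≡ x
  halves x y = begin
    1ℚ ℚ.* (d ℚ.* ½) ℚ.+ (y ℚ.+ (d ℚ.* ½) ℚ.* 1ℚ)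
      ≡⟨ cong₂ (λ a b → a ℚ.+ (y ℚ.+ b)) (ℚ.*-identityˡ (d ℚ.* ½)) (ℚ.*-identityʳ (d ℚ.* ½)) ⟩
    d ℚ.* ½ ℚ.+ (y ℚ.+ d ℚ.* ½)
      ≡⟨ cong (d ℚ.* ½ ℚ.+_) (ℚ.+-comm y (d ℚ.* ½)) ⟩
    d ℚ.* ½ ℚ.+ (d ℚ.* ½ ℚ.+ y)
      ≡⟨ ℚ.+-assoc (d ℚ.* ½) (d ℚ.* ½) y ⟨
    d ℚ.* ½ ℚ.+ d ℚ.* ½ ℚ.+ y
      ≡⟨ cong (ℚ._+ y) (ℚ.*-distribˡ-+ d ½ ½) ⟨
    d ℚ.* 1ℚ ℚ.+ y
      ≡⟨ cong (ℚ._+ y) (ℚ.*-identityʳ d) ⟩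
    x ℚ.- y ℚ.+ y
      ≡⟨ ℚ.+-assoc x (ℚ.- y) y ⟩
    x ℚ.+ (ℚ.- y ℚ.+ y)
      ≡⟨ cong (x ℚ.+_) (ℚ.+-inverseˡ y) ⟩
    x ℚ.+ 0ℚ
      ≡⟨ ℚ.+-identityʳ x ⟩
    x ∎
    where
    open ≡-Reasoning
    d = x ℚ.- y

√-square : ∀ f → f 0 ≡ 1ℚ → √ f * √ f ≗ f
√-square f f₀≡1 zero    = sym f₀≡1
√-square f f₀≡1 (suc n) = begin
  1ℚ ℚ.* s (suc n) ℚ.+ sum {suc n} term
    ≡⟨ cong (1ℚ ℚ.* s (suc n) ℚ.+_) (sum-init-last {n} term) ⟩
  1ℚ ℚ.* s (suc n) ℚ.+ (sum {n} (term ∘ inject₁) ℚ.+ term (fromℕ n))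
    ≡⟨ cong (1ℚ ℚ.* s (suc n) ℚ.+_) (cong₂ ℚ._+_ (sum-cong-≗ {n} inner) last-term) ⟩
  1ℚ ℚ.* s (suc n) ℚ.+ (Σ ℚ.+ s (suc n) ℚ.* 1ℚ)
    ≡⟨ cong (λ x → 1ℚ ℚ.* x ℚ.+ (Σ ℚ.+ x ℚ.* 1ℚ)) (√-suc f n) ⟩
  1ℚ ℚ.* ((f (suc n) ℚ.- Σ) ℚ.* ½) ℚ.+ (Σ ℚ.+ ((f (suc n) ℚ.- Σ) ℚ.* ½) ℚ.* 1ℚ)
    ≡⟨ halves (f (suc n)) Σ ⟩
  f (suc n) ∎
  where
  open ≡-Reasoning
  s = √ f
  Σ = sum {n} (λ i → s (suc (toℕ i)) ℚ.* s (n ∸ toℕ i))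
  term : Fin (suc n) → ℚ
  term i = s (suc (toℕ i)) ℚ.* s (n ∸ toℕ i)
  inner : ∀ i → term (inject₁ i) ≡ s (suc (toℕ i)) ℚ.* s (n ∸ toℕ i)
  inner i = cong (λ k → s (suc k) ℚ.* s (n ∸ k)) (toℕ-inject₁ i)
  last-term : term (fromℕ n) ≡ s (suc n) ℚ.* 1ℚ
  last-term = trans (cong (λ k → s (suc k) ℚ.* s (n ∸ k)) (toℕ-fromℕ n))
                    (cong (λ k → s (suc n) ℚ.* s k) (ℕ.n∸n≡0 n))

-- Being nonzero is witnessed by the lowest-order nonvanishing coefficient.

record NonZero (f : Series) : Set where
  field
    order   : ℕ
    below   : ∀ {n} → n ℕ.< order → f n ≡ 0ℚ
    leading : f order ≢ 0ℚ

*-≢0 : ∀ {x y} → x ≢ 0ℚ → y ≢ 0ℚ → x ℚ.* y ≢ 0ℚ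
*-≢0 {x} {y} x≢0 y≢0 xy≡0 = x≢0 (begin
  x                      ≡⟨ ℚ.*-identityʳ x ⟨
  x ℚ.* 1ℚ               ≡⟨ cong (x ℚ.*_) (ℚ.*-inverseʳ y) ⟨
  x ℚ.* (y ℚ.* ℚ.1/ y)   ≡⟨ ℚ.*-assoc x y _ ⟨
  x ℚ.* y ℚ.* ℚ.1/ y     ≡⟨ cong (ℚ._* ℚ.1/ y) xy≡0 ⟩
  0ℚ ℚ.* ℚ.1/ y          ≡⟨ ℚ.*-zeroˡ (ℚ.1/ y) ⟩
  0ℚ                     ∎)
  where
  open ≡-Reasoning
  instance _ = ℚ.≢-nonZero y≢0

*-nonZero : ∀ {f g} → NonZero f → NonZero g → NonZero (f * g)
*-nonZero {f} {g} f≢0 g≢0 = record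
  { order   = k ℕ.+ l
  ; below   = λ {n} n<k+l → sum-zero (λ i → term-zero n i (case ℕ.<-≤-connex (toℕ i) k of λ where
      (inj₁ i<k) → inj₁ i<k
      (inj₂ k≤i) → inj₂ (∸-< (ℕ.≤-pred (toℕ<n i)) k≤i n<k+l)))
  ; leading = λ eq → *-≢0 F.leading G.leading (trans (sym at-order) eq)
  }
  where
  module F = NonZero f≢0
  module G = NonZero g≢0
  k = F.order
  l = G.order

  sum-zero : ∀ {n} {h : Fin n → ℚ} → (∀ i → h i ≡ 0ℚ) → sum h ≡ 0ℚ
  sum-zero {n} h≡0 = trans (sum-cong-≗ h≡0) (sum-replicate-zero n)

  term-zero : ∀ n (i : Fin (suc n)) → toℕ i ℕ.< k ⊎ n ∸ toℕ i ℕ.< l →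
              f (toℕ i) ℚ.* g (n ∸ toℕ i) ≡ 0ℚ
  term-zero n i (inj₁ i<k) = trans (cong (ℚ._* _) (F.below i<k)) (ℚ.*-zeroˡ (g (n ∸ toℕ i)))
  term-zero n i (inj₂ j<l) = trans (cong (f (toℕ i) ℚ.*_) (G.below j<l)) (ℚ.*-zeroʳ (f (toℕ i)))

  ∸-< : ∀ {n i} → i ℕ.≤ n → k ℕ.≤ i → n ℕ.< k ℕ.+ l → n ∸ i ℕ.< l
  ∸-< {n} {i} i≤n k≤i n<k+l = ℕ.+-cancelˡ-< i _ _ (begin-strict
    i ℕ.+ (n ∸ i) ≡⟨ ℕ.m+[n∸m]≡n i≤n ⟩
    n             <⟨ n<k+l ⟩
    k ℕ.+ l       ≤⟨ ℕ.+-monoˡ-≤ l k≤i ⟩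
    i ℕ.+ l       ∎)
    where open ℕ.≤-Reasoning

  term : Fin (suc (k ℕ.+ l)) → ℚ
  term i = f (toℕ i) ℚ.* g (k ℕ.+ l ∸ toℕ i)

  k# : Fin (suc (k ℕ.+ l))
  k# = fromℕ< (s≤s (ℕ.m≤m+n k l))

  toℕ-k# : toℕ k# ≡ k
  toℕ-k# = toℕ-fromℕ< (s≤s (ℕ.m≤m+n k l))

  off-order : ∀ j → removeAt term k# j ≡ 0ℚ
  off-order j with ℕ.<-cmp (toℕ (punchIn k# j)) k
  ... | tri< i<k _ _ = term-zero _ (punchIn k# j) (inj₁ i<k)
  ... | tri≈ _ i≡k _ = contradiction (toℕ-injective (trans i≡k (sym toℕ-k#))) (punchInᵢ≢i k# j)
  ... | tri> _ _ k<i = term-zero _ (punchIn k# j) (inj₂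
    (ℕ.+-cancelˡ-< (toℕ i) _ _ (subst (ℕ._< toℕ i ℕ.+ l) (sym (ℕ.m+[n∸m]≡n (ℕ.≤-pred (toℕ<n i))))
      (ℕ.+-monoˡ-< l k<i))))
    where i = punchIn k# j

  at-order : (f * g) (k ℕ.+ l) ≡ f k ℚ.* g l
  at-order = begin
    sum term                                ≡⟨ sum-remove {i = k#} term ⟩
    term k# ℚ.+ sum (removeAt term k#)      ≡⟨ cong (term k# ℚ.+_) (sum-zero off-order) ⟩
    term k# ℚ.+ 0ℚ                          ≡⟨ ℚ.+-identityʳ (term k#) ⟩
    term k#                                 ≡⟨ cong (λ i → f i ℚ.* g (k ℕ.+ l ∸ i)) toℕ-k# ⟩
    f k ℚ.* g (k ℕ.+ l ∸ k)                 ≡⟨ cong (λ i → f k ℚ.* g i) (ℕ.m+n∸m≡n k l) ⟩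
    f k ℚ.* g l                             ∎
    where open ≡-Reasoning

record Fraction : Set where
  constructor fraction
  field
    numerator   : Series
    denominator : Series
    nonZero     : NonZero denominator

open Fraction

infixl 7 _/_
infixl 6 _⊖_
infix  4 _≈_

_/_ : (f g : Series) → {{NonZero g}} → Fraction
_/_ f g {{g≢0}} = fraction f g g≢0

_⊖_ : Fraction → Fraction → Fraction
x ⊖ y = fraction
  (numerator x * denominator y - numerator y * denominator x)
  (denominator x * denominator y)
  (*-nonZero (nonZero x) (nonZero y))

_≈_ : Fraction → Fraction → Set
x ≈ y = numerator x * denominator y ≗ numerator y * denominator x

instance
  1-nonZero : NonZero 1
  1-nonZero = record { order = 0 ; below = λ () ; leading = λ () }

  2t²⟨1-3t+t²⟩-nonZero : NonZero (2 * t ^ 2 * (1 - 3 * t + t ^ 2))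
  2t²⟨1-3t+t²⟩-nonZero = record
    { order   = 2
    ; below   = λ { {0} _ → refl ; {1} _ → refl ; {suc (suc _)} (s≤s (s≤s ())) }
    ; leading = λ ()
    }

  2t²⟨1-t⟩²⟨1-3t+t²⟩-nonZero : NonZero (2 * t ^ 2 * (1 - t) ^ 2 * (1 - 3 * t + t ^ 2))
  2t²⟨1-t⟩²⟨1-3t+t²⟩-nonZero = record
    { order   = 2
    ; below   = λ { {0} _ → refl ; {1} _ → refl ; {suc (suc _)} (s≤s (s≤s ())) }
    ; leading = λ ()
    }

↑ : Series → Fraction
↑ f = f / 1

{-# OPTIONS --safe #-}

-- A partition avoiding both patterns is 1 2 … m followed by a word in the
-- letters up to m + 1 which, apart from restrictions on m and m + 1, avoids 123
-- and uses each letter below m at most once. Reading it from left to right, the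
-- state is given by the numbers a and b of letters below m that are still legal
-- and lie below, respectively above, the least repeated letter. Summing over the
-- length of the initial run amounts to summing over a with weights tᵃ; the
-- transitions then become linear recurrences in b alone, whose solutions are
-- geometric, c rᵇ, with r = 1 + t ρ for the Catalan-type series
-- ρ = 1 + t² ρ² / (1 − t). The generating function is thus rational in t and ρ.

module Submission where

open import Defs hiding (fromNat)
open import Algebra.Bundles using (CommutativeRing)
import Algebra.Properties.CommutativeSemigroup
import Algebra.Properties.Group
import Algebra.Solver.Ring
open import Algebra.Solver.Ring.AlmostCommutativeRing using (fromCommutativeRing; _-Raw-AlmostCommutative⟶_)
open import Algebra.Structures using (IsCommutativeRing)
open import Data.Bool.Base using (Bool; true; false; if_then_else_)
open import Data.Fin.Base as Fin using (cast)
open import Data.Integer.Base as ℤ using (ℤ; +_)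
import Data.Integer.Properties as ℤ
open import Data.List.Base using (List; []; _∷_; length; lookup; map; concatMap; applyUpTo; filter; reverse; [_]; _ʳ++_; _++_)
open import Data.List.Properties using (length-++; filter-++; filter-none; filter-accept; ʳ++-defn; reverse-involutive)
open import Data.List.Relation.Binary.Sublist.Propositional using (_⊆_; []; _∷_; _∷ʳ_; minimum; ⊆-refl; ⊆-trans)
open import Data.List.Relation.Binary.Sublist.Propositional.Properties using (++⁺ʳ; reverse⁺)
open import Data.List.Relation.Unary.All as All using ([]; _∷_)
open import Data.Maybe.Base using (Maybe; just; nothing; maybe′)
open import Data.Nat.Base as ℕ using (ℕ; zero; suc; z≤n; s≤s; _∸_; _⊔_)
import Data.Nat.Properties as ℕ
import Data.Nat.Solver as ℕ
open import Data.Product.Base using (∃; _×_; _,_; proj₁; proj₂)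
open import Data.Rational.Base as ℚ using (ℚ; 0ℚ; 1ℚ; ½)
open import Data.Rational.Literals using (fromℤ)
import Data.Rational.Properties as ℚ
import Data.Rational.Solver as ℚ
import Data.Rational.Unnormalised.Base as ℚᵘ
import Data.Rational.Unnormalised.Properties as ℚᵘ
open import Data.Sum.Base using (_⊎_; inj₁; inj₂)
open import Function.Base using (_∘_)
open import Function.Bundles using (_⇔_; mk⇔; module Equivalence)
open import Level using (0ℓ)
open import Relation.Binary.Definitions using (tri<; tri≈; tri>)
open import Relation.Binary.PropositionalEquality hiding ([_])
open import Relation.Nullary.Decidable using (does; yes; no)
open import Relation.Nullary.Negation using (¬_; contradiction)
open import Relation.Unary using (Decidable)
open Equivalence using (to; from)

-- Words

-- The states of a word after its first repeated letter. Let 1 2 … m be its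
-- initial run, so that only n = m + 1 may still be a new letter, and call the
-- letters below m small. Without ° a small letter has been repeated, with °
-- only m has; the name says which of m and n may follow: onlyₘ and onlyₙ allow
-- the letter any number of times, once allows n freely but m only once, and
-- both allows each of them (n turning it into once, and m, unless °, into onlyₘ).

-- The initial run already supplies the first letters of most occurrences. If x < b < c are read in
-- this order after the run, with x ≤ m, the copy of x in the run completes 1123. A small letter x
-- has been followed by x + 1 inside the run, so two further copies of x complete 1211. The letter m
-- gets into that position only once n = m + 1 has been read, while n + 1 can never occur: a
-- repeated letter, n and n + 1 would complete 1123. This special behaviour of m and n is what
-- forces several kinds of state, whereas for the small letters the numbers of legal ones suffice.

data Kind : Set where
  none onlyₘ onlyₙ once both onlyₙ° once° both° : Kind

low : Kind → Kind
low none   = none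
low onlyₘ  = onlyₘ
low onlyₙ  = onlyₙ
low once   = once
low both   = both
low onlyₙ° = onlyₙ
low once°  = once
low both°  = both

afterₘ afterₙ : Kind → Maybe Kind
afterₘ none   = nothing
afterₘ onlyₘ  = just onlyₘ
afterₘ onlyₙ  = nothing
afterₘ once   = just none
afterₘ both   = just onlyₘ
afterₘ onlyₙ° = nothing
afterₘ once°  = just onlyₙ°
afterₘ both°  = just both°

afterₙ none   = nothing
afterₙ onlyₘ  = nothing
afterₙ onlyₙ  = just onlyₙ
afterₙ once   = just once
afterₙ both   = just once
afterₙ onlyₙ° = just onlyₙ°
afterₙ once°  = just once°
afterₙ both°  = just once°

-- The second argument is an accumulator: choosing the legal letter of rank i leaves i letters below
-- it, and those skipped join b. Stepping from b to `suc b` in the recursion becomes the shift of b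
-- in `Y-eq`.
sumLow : (ℕ → ℕ → ℕ) → ℕ → ℕ → ℕ
sumLow f zero    b = 0
sumLow f (suc a) b = f a b ℕ.+ sumLow f a (suc b)

sumBelow : ℕ → (ℕ → ℕ) → ℕ
sumBelow zero    f = 0
sumBelow (suc b) f = f b ℕ.+ sumBelow b f

-- F k a b n counts the continuations of length n from a state of kind k in
-- which a small letters below the least repeated letter and b above it are
-- legal. Reading a letter of the first kind moves the legal letters between it
-- and the least repeated letter from a to b; reading one of the second kind
-- creates an ascent above a repeated letter and forbids all larger letters.

F : Kind → ℕ → ℕ → ℕ → ℕ
F k a b zero    = 1
F k a b (suc n) = sumLow (λ i j → F (low k) i j n) a b ℕ.+ sumBelow b (λ i → F none a i n)
  ℕ.+ (maybe′ (λ k′ → F k′ a b n) 0 (afterₘ k) ℕ.+ maybe′ (λ k′ → F k′ a b n) 0 (afterₙ k))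

firstRepeat : ℕ → ℕ → ℕ
firstRepeat a n = sumLow (λ i j → F both i j n) a 0 ℕ.+ F both° a 0 n

initialRun : ℕ → ℕ → ℕ
initialRun a zero    = 1
initialRun a (suc n) = initialRun (suc a) n ℕ.+ firstRepeat a n

-- Occurrences of the two patterns

τ₁ τ₂ : List ℕ
τ₁ = 1 ∷ 1 ∷ 2 ∷ 3 ∷ []
τ₂ = 1 ∷ 2 ∷ 1 ∷ 1 ∷ []

patterns : List (List ℕ)
patterns = τ₁ ∷ τ₂ ∷ []

increasing-reflects : ∀ {f : ℕ → ℕ} → (∀ {x y} → x ℕ.< y → f x ℕ.< f y) → ∀ {x y} → f x ℕ.< f y → x ℕ.< y
increasing-reflects f-inc {x} {y} fx<fy with ℕ.<-cmp x y
... | tri< x<y _ _  = x<y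
... | tri≈ _ refl _ = contradiction fx<fy (ℕ.<-irrefl refl)
... | tri> _ _ y<x  = contradiction fx<fy (ℕ.<-asym (f-inc y<x))

-- An increasing map both preserves and reflects the order, so it is enough to match single letters;
-- pairs of positions require no case distinction.
orderIsomorphic : ∀ {u v} (eq : length u ≡ length v) {f : ℕ → ℕ} → (∀ {x y} → x ℕ.< y → f x ℕ.< f y) →
  (∀ i → ∃ λ k → lookup v (cast eq i) ≡ suc k × lookup u i ≡ f k) → OrderIsomorphic u v
orderIsomorphic eq {f} f-inc letters = eq , λ i j → same (letters i) (letters j)
  where
  same : ∀ {x y x′ y′} → (∃ λ k → x′ ≡ suc k × x ≡ f k) → (∃ λ k → y′ ≡ suc k × y ≡ f k) → (x ℕ.< y) ⇔ (x′ ℕ.< y′)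
  same (k , refl , refl) (l , refl , refl) = mk⇔ (λ lt → s≤s (increasing-reflects f-inc lt)) (λ { (s≤s lt) → f-inc lt })

-- `orderIsomorphic` asks for a map increasing on all of ℕ, so the values a, b, c are continued by c
-- + 1, c + 2, ....
extend : ℕ → ℕ → ℕ → ℕ → ℕ
extend a b c 0             = a
extend a b c 1             = b
extend a b c (suc (suc n)) = n ℕ.+ c

extend-increasing : ∀ {a b c} → a ℕ.< b → b ℕ.< c → ∀ {x y} → x ℕ.< y → extend a b c x ℕ.< extend a b c y
extend-increasing a<b b<c {0} {1} _ = a<b
extend-increasing {c = c} a<b b<c {0} {suc (suc y)} _ = ℕ.<-≤-trans (ℕ.<-trans a<b b<c) (ℕ.m≤n+m c y)
extend-increasing {c = c} a<b b<c {1} {suc (suc y)} _ = ℕ.<-≤-trans b<c (ℕ.m≤n+m c y)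
extend-increasing a<b b<c {1} {1} (s≤s ())
extend-increasing a<b b<c {suc (suc x)} {1} (s≤s ())
extend-increasing {c = c} a<b b<c {suc (suc x)} {suc (suc y)} (s≤s (s≤s lt)) = ℕ.+-monoˡ-< c lt

private
  ≮⇒≡ : ∀ {x y} → ¬ (x ℕ.< y) → ¬ (y ℕ.< x) → x ≡ y
  ≮⇒≡ x≮y y≮x = ℕ.≤-antisym (ℕ.≮⇒≥ y≮x) (ℕ.≮⇒≥ x≮y)

contains-1123 : ∀ {w} → Contains w τ₁ ⇔ (∃ λ a → ∃ λ b → ∃ λ c → a ℕ.< b × b ℕ.< c × (a ∷ a ∷ b ∷ c ∷ []) ⊆ w)
contains-1123 {w} = mk⇔ letters λ (a , b , c , a<b , b<c , sub) → _ , sub , orderIsomorphic refl (extend-increasing a<b b<c) λ where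
    Fin.zero                   → 0 , refl , refl
    (Fin.suc Fin.zero)             → 0 , refl , refl
    (Fin.suc (Fin.suc Fin.zero))       → 1 , refl , refl
    (Fin.suc (Fin.suc (Fin.suc Fin.zero))) → 2 , refl , refl
  where
  letters : Contains w τ₁ → _
  letters (a ∷ a′ ∷ b ∷ c ∷ [] , sub , refl , iso)
    -- Equal letters of the pattern are incomparable, hence so are the corresponding letters of the
    -- word, and these coincide.
    with refl ← ≮⇒≡ (λ lt → ℕ.<-irrefl refl (to (iso Fin.zero (Fin.suc Fin.zero)) lt)) (λ lt → ℕ.<-irrefl refl (to (iso (Fin.suc Fin.zero) Fin.zero) lt)) =
    a , b , c , from (iso Fin.zero (Fin.suc (Fin.suc Fin.zero))) ℕ.≤-refl , from (iso (Fin.suc (Fin.suc Fin.zero)) (Fin.suc (Fin.suc (Fin.suc Fin.zero)))) ℕ.≤-refl , sub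

contains-1211 : ∀ {w} → Contains w τ₂ ⇔ (∃ λ a → ∃ λ b → a ℕ.< b × (a ∷ b ∷ a ∷ a ∷ []) ⊆ w)
-- This pattern has only two distinct letters; `suc b` fills the third place of `extend`.
contains-1211 {w} = mk⇔ letters λ (a , b , a<b , sub) → _ , sub , orderIsomorphic refl (extend-increasing a<b (ℕ.n<1+n b)) λ where
    Fin.zero                   → 0 , refl , refl
    (Fin.suc Fin.zero)             → 1 , refl , refl
    (Fin.suc (Fin.suc Fin.zero))       → 0 , refl , refl
    (Fin.suc (Fin.suc (Fin.suc Fin.zero))) → 0 , refl , refl
  where
  letters : Contains w τ₂ → _
  letters (a ∷ b ∷ a′ ∷ a″ ∷ [] , sub , refl , iso)
    with refl ← ≮⇒≡ (λ lt → ℕ.<-irrefl refl (to (iso Fin.zero (Fin.suc (Fin.suc Fin.zero))) lt)) (λ lt → ℕ.<-irrefl refl (to (iso (Fin.suc (Fin.suc Fin.zero)) Fin.zero) lt))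
       | refl ← ≮⇒≡ (λ lt → ℕ.<-irrefl refl (to (iso Fin.zero (Fin.suc (Fin.suc (Fin.suc Fin.zero)))) lt)) (λ lt → ℕ.<-irrefl refl (to (iso (Fin.suc (Fin.suc (Fin.suc Fin.zero))) Fin.zero) lt)) =
    a , b , from (iso Fin.zero (Fin.suc Fin.zero)) ℕ.≤-refl , sub

-- Words are kept reversed, so that reading a letter is a cons.

Doubled Ascent Rise Return : List ℕ → ℕ → Set
Doubled r x = ∃ λ a → a ℕ.< x × (a ∷ a ∷ []) ⊆ r
Ascent  r x = ∃ λ b → x ℕ.< b × (b ∷ x ∷ []) ⊆ r
Rise    r x = ∃ λ b → b ℕ.< x × ∃ λ a → a ℕ.< b × (b ∷ a ∷ a ∷ []) ⊆ r
Return  r x = ∃ λ b → x ℕ.< b × (x ∷ b ∷ x ∷ []) ⊆ r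

data Bad (r : List ℕ) : Set where
  bad₁ : ∀ {a b c} → a ℕ.< b → b ℕ.< c → (c ∷ b ∷ a ∷ a ∷ []) ⊆ r → Bad r
  bad₂ : ∀ {a b} → a ℕ.< b → (a ∷ a ∷ b ∷ a ∷ []) ⊆ r → Bad r

avoids-reverse : ∀ {r} → Avoids patterns (reverse r) ⇔ (¬ Bad r)
avoids-reverse {r} = mk⇔ only-if-good if-good
  where
  only-if-good : Avoids patterns (reverse r) → ¬ Bad r
  only-if-good (¬c₁ ∷ ¬c₂ ∷ []) (bad₁ a<b b<c sub) = ¬c₁ (from contains-1123 (_ , _ , _ , a<b , b<c , reverse⁺ sub))
  only-if-good (¬c₁ ∷ ¬c₂ ∷ []) (bad₂ a<b sub)     = ¬c₂ (from contains-1211 (_ , _ , a<b , reverse⁺ sub))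
  unreverse : ∀ {v} → v ⊆ reverse r → reverse v ⊆ r
  unreverse sub = subst (_ ⊆_) (reverse-involutive r) (reverse⁺ sub)
  if-good : ¬ Bad r → Avoids patterns (reverse r)
  if-good ¬bad = (λ c → let (_ , _ , _ , a<b , b<c , sub) = to contains-1123 c in ¬bad (bad₁ a<b b<c (unreverse sub)))
            ∷ (λ c → let (_ , _ , a<b , sub) = to contains-1211 c in ¬bad (bad₂ a<b (unreverse sub)))
            ∷ []

module _ {z : ℕ} {r : List ℕ} where

  Doubled-∷ : ∀ {x} → Doubled (z ∷ r) x ⇔ (Doubled r x ⊎ (z ℕ.< x × [ z ] ⊆ r))
  Doubled-∷ = mk⇔ (λ { (a , a<x , _ ∷ʳ sub) → inj₁ (a , a<x , sub) ; (a , a<x , refl ∷ sub) → inj₂ (a<x , sub) })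
    (λ { (inj₁ (a , a<x , sub)) → a , a<x , z ∷ʳ sub ; (inj₂ (z<x , sub)) → z , z<x , refl ∷ sub })

  Ascent-∷ : ∀ {x} → Ascent (z ∷ r) x ⇔ (Ascent r x ⊎ (x ℕ.< z × [ x ] ⊆ r))
  Ascent-∷ = mk⇔ (λ { (a , a<x , _ ∷ʳ sub) → inj₁ (a , a<x , sub) ; (a , a<x , refl ∷ sub) → inj₂ (a<x , sub) })
    (λ { (inj₁ (a , a<x , sub)) → a , a<x , z ∷ʳ sub ; (inj₂ (z<x , sub)) → z , z<x , refl ∷ sub })

  Rise-∷ : ∀ {x} → Rise (z ∷ r) x ⇔ (Rise r x ⊎ (z ℕ.< x × Doubled r z))
  Rise-∷ = mk⇔ (λ { (b , b<x , a , a<b , _ ∷ʳ sub) → inj₁ (b , b<x , a , a<b , sub) ; (b , b<x , a , a<b , refl ∷ sub) → inj₂ (b<x , a , a<b , sub) })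
    (λ { (inj₁ (b , b<x , a , a<b , sub)) → b , b<x , a , a<b , z ∷ʳ sub ; (inj₂ (z<x , a , a<b , sub)) → z , z<x , a , a<b , refl ∷ sub })

  Return-∷ : ∀ {x} → Return (z ∷ r) x ⇔ (Return r x ⊎ (x ≡ z × Ascent r x))
  Return-∷ = mk⇔ (λ { (b , x<b , _ ∷ʳ sub) → inj₁ (b , x<b , sub) ; (b , x<b , refl ∷ sub) → inj₂ (refl , b , x<b , sub) })
    (λ { (inj₁ (b , x<b , sub)) → b , x<b , z ∷ʳ sub ; (inj₂ (refl , b , x<b , sub)) → b , x<b , refl ∷ sub })

  -- The predicates follow the prefixes of the patterns: `Doubled` (11) grows into `Rise` (112), and
  -- `Ascent` (12) into `Return` (121). An occurrence is created exactly when z supplies the last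
  -- letter after one of the two longer prefixes.
  Bad-∷ : Bad (z ∷ r) ⇔ (Bad r ⊎ Rise r z ⊎ Return r z)
  Bad-∷ = mk⇔
    (λ { (bad₁ a<b b<c (_ ∷ʳ sub)) → inj₁ (bad₁ a<b b<c sub)
       ; (bad₁ a<b b<c (refl ∷ sub)) → inj₂ (inj₁ (_ , b<c , _ , a<b , sub))
       ; (bad₂ a<b (_ ∷ʳ sub)) → inj₁ (bad₂ a<b sub)
       ; (bad₂ a<b (refl ∷ sub)) → inj₂ (inj₂ (_ , a<b , sub)) })
    (λ { (inj₁ (bad₁ a<b b<c sub)) → bad₁ a<b b<c (z ∷ʳ sub)
       ; (inj₁ (bad₂ a<b sub)) → bad₂ a<b (z ∷ʳ sub)
       ; (inj₂ (inj₁ (_ , b<c , _ , a<b , sub))) → bad₁ a<b b<c (refl ∷ sub)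
       ; (inj₂ (inj₂ (_ , a<b , sub))) → bad₂ a<b (refl ∷ sub) })

  singleton-∷ : ∀ {x} → [ x ] ⊆ z ∷ r ⇔ (x ≡ z ⊎ [ x ] ⊆ r)
  singleton-∷ = mk⇔ (λ { (_ ∷ʳ sub) → inj₂ sub ; (refl ∷ _) → inj₁ refl })
    (λ { (inj₁ refl) → refl ∷ minimum r ; (inj₂ sub) → z ∷ʳ sub })

-- Counting completions letter by letter

length-filter-map : ∀ {A B : Set} {P : B → Set} (P? : Decidable P) (f : A → B) xs →
  length (filter P? (map f xs)) ≡ length (filter (P? ∘ f) xs)
length-filter-map P? f []       = refl
length-filter-map P? f (x ∷ xs) with does (P? (f x))
... | true  = cong suc (length-filter-map P? f xs)
... | false = length-filter-map P? f xs

sumBelow-cong : ∀ k {f g : ℕ → ℕ} → (∀ i → i ℕ.< k → f i ≡ g i) → sumBelow k f ≡ sumBelow k g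
sumBelow-cong zero    eq = refl
sumBelow-cong (suc k) eq = cong₂ ℕ._+_ (eq k ℕ.≤-refl) (sumBelow-cong k (λ i i<k → eq i (ℕ.m<n⇒m<1+n i<k)))

sumBelow-head : ∀ k f → f 0 ℕ.+ sumBelow k (f ∘ suc) ≡ sumBelow (suc k) f
sumBelow-head zero    f = refl
sumBelow-head (suc k) f = trans (x∙yz≈y∙xz (f 0) (f (suc k)) (sumBelow k (f ∘ suc))) (cong (f (suc k) ℕ.+_) (sumBelow-head k f))
  where open Algebra.Properties.CommutativeSemigroup ℕ.+-commutativeSemigroup using (x∙yz≈y∙xz)

length-filter-concatMap : ∀ {A B : Set} {P : B → Set} (P? : Decidable P) (g : A → List B) (h : ℕ → A) k →
  length (filter P? (concatMap g (applyUpTo h k))) ≡ sumBelow k (λ i → length (filter P? (g (h i))))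
length-filter-concatMap P? g h zero    = refl
length-filter-concatMap P? g h (suc k) = begin
  length (filter P? (g (h 0) ++ concatMap g (applyUpTo (h ∘ suc) k)))
    ≡⟨ cong length (filter-++ P? (g (h 0)) _) ⟩
  length (filter P? (g (h 0)) ++ filter P? (concatMap g (applyUpTo (h ∘ suc) k)))
    ≡⟨ length-++ (filter P? (g (h 0))) ⟩
  length (filter P? (g (h 0))) ℕ.+ length (filter P? (concatMap g (applyUpTo (h ∘ suc) k)))
    ≡⟨ cong (length (filter P? (g (h 0))) ℕ.+_) (length-filter-concatMap P? g (h ∘ suc) k) ⟩
  length (filter P? (g (h 0))) ℕ.+ sumBelow k (λ i → length (filter P? (g (h (suc i)))))
    ≡⟨ sumBelow-head k _ ⟩
  sumBelow (suc k) (λ i → length (filter P? (g (h i)))) ∎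
  where open ≡-Reasoning

-- The word read so far is `reverse r`. As `(x ∷ r) ʳ++ w` is `r ʳ++ (x ∷ w)` by definition, moving
-- a letter from the continuation to the prefix leaves the avoidance predicate unchanged.
completions : List ℕ → ℕ → ℕ → ℕ
completions r M n = length (filter (λ w → avoids? patterns (r ʳ++ w)) (continuations M n))

completions-suc : ∀ r M n → completions r M (suc n) ≡ sumBelow (suc M) (λ i → completions (suc i ∷ r) (M ⊔ suc i) n)
completions-suc r M n = trans
  (length-filter-concatMap (λ w → avoids? patterns (r ʳ++ w)) (λ x → map (x ∷_) (continuations (M ⊔ x) n)) suc (suc M))
  (sumBelow-cong (suc M) (λ i _ → length-filter-map (λ w → avoids? patterns (r ʳ++ w)) (suc i ∷_) (continuations (M ⊔ suc i) n)))

completions-zero : ∀ {r M} → ¬ Bad r → completions r M 0 ≡ 1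
completions-zero {r} ¬bad = cong length
  (filter-accept (λ w → avoids? patterns (r ʳ++ w)) {xs = []} (from avoids-reverse ¬bad))

completions-bad : ∀ {r} M n → Bad r → completions r M n ≡ 0
completions-bad {r} M n bad = cong length (filter-none (λ w → avoids? patterns (r ʳ++ w))
  (All.universal (λ w avoids → to avoids-reverse (prefix w avoids) bad) (continuations M n)))
  where
  prefix : ∀ w → Avoids patterns (r ʳ++ w) → Avoids patterns (reverse r)
  prefix w = All.map (λ ¬c (v , sub , iso) → ¬c (v , ⊆-trans sub (subst (reverse r ⊆_) (sym (ʳ++-defn r)) (++⁺ʳ w ⊆-refl)) , iso))

-- Legal letters

count : (ℕ → Bool) → ℕ → ℕ
count av zero    = 0
count av (suc k) = (if av k then 1 else 0) ℕ.+ count av k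

count-mono : ∀ av {l k} → l ℕ.≤ k → count av l ℕ.≤ count av k
count-mono av {l} {k} l≤k with ℕ.m≤n⇒m<n∨m≡n l≤k
... | inj₂ refl = ℕ.≤-refl
count-mono av {l} {suc k} l≤k | inj₁ (s≤s l≤k′) = ℕ.≤-trans (count-mono av l≤k′) (ℕ.m≤n+m _ (if av k then 1 else 0))

count-true : ∀ av {k} → av k ≡ true → count av (suc k) ≡ suc (count av k)
count-true av {k} eq = cong (λ b → (if b then 1 else 0) ℕ.+ count av k) eq

count-false : ∀ av {k} → av k ≡ false → count av (suc k) ≡ count av k
count-false av {k} eq = cong (λ b → (if b then 1 else 0) ℕ.+ count av k) eq

count-cong : ∀ {av av′} k → (∀ i → i ℕ.< k → av i ≡ av′ i) → count av k ≡ count av′ k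
count-cong zero    eq = refl
count-cong (suc k) eq = cong₂ (λ b c → (if b then 1 else 0) ℕ.+ c) (eq k ℕ.≤-refl) (count-cong k (λ i i<k → eq i (ℕ.m<n⇒m<1+n i<k)))

module _ (av : ℕ → Bool) (K : ℕ) (term : ℕ → ℕ) where

  -- Letters are replaced by their ranks among the legal ones, which is why two numbers can stand
  -- for the whole set of legal letters.
  sumLow-count : ∀ (f : ℕ → ℕ → ℕ) l → l ℕ.≤ K →
    (∀ i → i ℕ.< l → av i ≡ true → term i ≡ f (count av i) (count av K ∸ count av (suc i))) →
    (∀ i → i ℕ.< l → av i ≡ false → term i ≡ 0) →
    sumBelow l term ≡ sumLow f (count av l) (count av K ∸ count av l)
  sumLow-count f zero    l<K legal illegal = refl
  sumLow-count f (suc l) l<K legal illegal with av l in eq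
  ... | false = cong₂ ℕ._+_ (illegal l ℕ.≤-refl eq)
                  (sumLow-count f l (ℕ.<⇒≤ l<K) (λ i i<l → legal i (ℕ.m<n⇒m<1+n i<l)) (λ i i<l → illegal i (ℕ.m<n⇒m<1+n i<l)))
  ... | true  = cong₂ ℕ._+_ (trans (legal l ℕ.≤-refl eq) (cong (λ c → f (count av l) (count av K ∸ c)) (count-true av eq)))
    (trans (sumLow-count f l (ℕ.<⇒≤ l<K) (λ i i<l → legal i (ℕ.m<n⇒m<1+n i<l)) (λ i i<l → illegal i (ℕ.m<n⇒m<1+n i<l)))
      -- The letter of index l is legal and lies below K, so it adds exactly one to the truncated
      -- difference: this is the `suc b` in `sumLow`.
      (cong (sumLow f (count av l)) (ℕ.+-∸-assoc 1 (subst (ℕ._≤ count av K) (count-true av eq) (count-mono av l<K)))))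

  sumBelow-count : ∀ (g : ℕ → ℕ) l j →
    (∀ i → l ℕ.≤ i → i ℕ.< j ℕ.+ l → av i ≡ true → term i ≡ g (count av i ∸ count av l)) →
    (∀ i → l ℕ.≤ i → i ℕ.< j ℕ.+ l → av i ≡ false → term i ≡ 0) →
    sumBelow (j ℕ.+ l) term ≡ sumBelow (count av (j ℕ.+ l) ∸ count av l) g ℕ.+ sumBelow l term
  sumBelow-count g l zero    legal illegal = cong (λ c → sumBelow c g ℕ.+ sumBelow l term) (sym (ℕ.n∸n≡0 (count av l)))
  sumBelow-count g l (suc j) legal illegal
    with ih ← sumBelow-count g l j (λ i l≤i i< → legal i l≤i (ℕ.m<n⇒m<1+n i<)) (λ i l≤i i< → illegal i l≤i (ℕ.m<n⇒m<1+n i<)) | av (j ℕ.+ l) in eq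
  ... | false = cong₂ ℕ._+_ (illegal (j ℕ.+ l) (ℕ.m≤n+m l j) ℕ.≤-refl eq) ih
  ... | true  = trans (cong₂ ℕ._+_ (legal (j ℕ.+ l) (ℕ.m≤n+m l j) ℕ.≤-refl eq) ih) (trans
    (sym (ℕ.+-assoc (g (count av (j ℕ.+ l) ∸ count av l)) _ _))
    (cong (λ c → sumBelow c g ℕ.+ sumBelow l term) (sym (ℕ.+-∸-assoc 1 (count-mono av (ℕ.m≤n+m l j))))))

Illegal : List ℕ → ℕ → Set
Illegal r x = Rise r x ⊎ Return r x

module _ {z : ℕ} {r : List ℕ} where

  Illegal-∷⁻ : ∀ {x} → Illegal (z ∷ r) x → Illegal r x ⊎ (z ℕ.< x × Doubled r z) ⊎ (x ≡ z × Ascent r x)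
  Illegal-∷⁻ (inj₁ rise) with to Rise-∷ rise
  ... | inj₁ old = inj₁ (inj₁ old)
  ... | inj₂ new = inj₂ (inj₁ new)
  Illegal-∷⁻ (inj₂ return) with to Return-∷ return
  ... | inj₁ old = inj₁ (inj₂ old)
  ... | inj₂ new = inj₂ (inj₂ new)

  Rise-weaken : ∀ {x} → Rise r x → Rise (z ∷ r) x
  Rise-weaken = from Rise-∷ ∘ inj₁

  Return-weaken : ∀ {x} → Return r x → Return (z ∷ r) x
  Return-weaken = from Return-∷ ∘ inj₁

  Illegal-weaken : ∀ {x} → Illegal r x → Illegal (z ∷ r) x
  Illegal-weaken (inj₁ rise)   = inj₁ (Rise-weaken rise)
  Illegal-weaken (inj₂ return) = inj₂ (Return-weaken return)

Rise-mono : ∀ {r x y} → x ℕ.≤ y → Rise r x → Rise r y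
Rise-mono x≤y (b , b<x , a) = b , ℕ.<-≤-trans b<x x≤y , a

-- New letters appear in increasing order, so exactly the letters below the maximum have been
-- followed by a larger one. Reading one of them again therefore creates a `Return` at once.
record Prefix (r : List ℕ) (M : ℕ) : Set where
  field
    good    : ¬ Bad r
    letters : ∀ {x} → [ x ] ⊆ r ⇔ (1 ℕ.≤ x × x ℕ.≤ M)
    ascents : ∀ {x} → Ascent r x ⇔ (1 ℕ.≤ x × x ℕ.< M)

open Prefix

good-∷ : ∀ {z r} → ¬ Bad r → ¬ Illegal r z → ¬ Bad (z ∷ r)
good-∷ ¬bad ¬illegal bad with to Bad-∷ bad
... | inj₁ old     = ¬bad old
... | inj₂ illegal = ¬illegal illegal

prefix-old : ∀ {z r M} → Prefix r M → ¬ Illegal r z → 1 ℕ.≤ z → z ℕ.≤ M → Prefix (z ∷ r) M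
prefix-old {z} {r} {M} pre ¬illegal 1≤z z≤M = record
  { good    = good-∷ (good pre) ¬illegal
  ; letters = mk⇔ (λ sub → letter-cases (to singleton-∷ sub)) (from singleton-∷ ∘ inj₂ ∘ from (letters pre))
  ; ascents = mk⇔ (λ asc → ascent-cases (to Ascent-∷ asc)) (from Ascent-∷ ∘ inj₁ ∘ from (ascents pre))
  }
  where
  letter-cases : ∀ {x} → x ≡ z ⊎ [ x ] ⊆ r → 1 ℕ.≤ x × x ℕ.≤ M
  letter-cases (inj₁ refl) = 1≤z , z≤M
  letter-cases (inj₂ sub)  = to (letters pre) sub
  ascent-cases : ∀ {x} → Ascent r x ⊎ (x ℕ.< z × [ x ] ⊆ r) → 1 ℕ.≤ x × x ℕ.< M
  ascent-cases (inj₁ asc)         = to (ascents pre) asc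
  ascent-cases (inj₂ (x<z , sub)) = proj₁ (to (letters pre) sub) , ℕ.<-≤-trans x<z z≤M

prefix-new : ∀ {r M} → Prefix r M → ¬ Illegal r (suc M) → Prefix (suc M ∷ r) (suc M)
prefix-new {r} {M} pre ¬illegal = record
  { good    = good-∷ (good pre) ¬illegal
  ; letters = mk⇔ (λ sub → letter-cases (to singleton-∷ sub)) (λ (1≤x , x≤) → letter-of 1≤x (ℕ.m≤n⇒m<n∨m≡n x≤))
  ; ascents = mk⇔ (λ asc → ascent-cases (to Ascent-∷ asc)) (λ (1≤x , x<) → from Ascent-∷ (inj₂ (x< , from (letters pre) (1≤x , ℕ.≤-pred x<))))
  }
  where
  letter-cases : ∀ {x} → x ≡ suc M ⊎ [ x ] ⊆ r → 1 ℕ.≤ x × x ℕ.≤ suc M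
  letter-cases (inj₁ refl) = s≤s z≤n , ℕ.≤-refl
  letter-cases (inj₂ sub)  = let 1≤x , x≤M = to (letters pre) sub in 1≤x , ℕ.m≤n⇒m≤1+n x≤M
  letter-of : ∀ {x} → 1 ℕ.≤ x → x ℕ.< suc M ⊎ x ≡ suc M → [ x ] ⊆ suc M ∷ r
  letter-of 1≤x (inj₁ x<)  = from singleton-∷ (inj₂ (from (letters pre) (1≤x , ℕ.≤-pred x<)))
  letter-of 1≤x (inj₂ eq)  = from singleton-∷ (inj₁ eq)
  ascent-cases : ∀ {x} → Ascent r x ⊎ (x ℕ.< suc M × [ x ] ⊆ r) → 1 ℕ.≤ x × x ℕ.< suc M
  ascent-cases (inj₁ asc)         = let 1≤x , x<M = to (ascents pre) asc in 1≤x , ℕ.m<n⇒m<1+n x<M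
  ascent-cases (inj₂ (x<z , sub)) = proj₁ (to (letters pre) sub) , x<z

-- The index x stands for the letter x + 1. Only small letters are recorded here; the legality of m
-- and n is the business of `Status`.
record Available (K : ℕ) (r : List ℕ) (av : ℕ → Bool) : Set where
  field
    legal   : ∀ {x} → x ℕ.< K → av x ≡ true → ¬ Illegal r (suc x)
    illegal : ∀ {x} → x ℕ.< K → av x ≡ false → Illegal r (suc x)

open Available

remove keepBelow : ℕ → (ℕ → Bool) → ℕ → Bool
remove x av y with y ℕ.≟ x
... | yes _ = false
... | no  _ = av y
keepBelow x av y with y ℕ.<? x
... | yes _ = av y
... | no  _ = false

remove-≢ : ∀ {x av y} → y ≢ x → remove x av y ≡ av y
remove-≢ {x} {av} {y} y≢x with y ℕ.≟ x
... | yes y≡x = contradiction y≡x y≢x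
... | no  _   = refl

remove-≡ : ∀ {x av} → remove x av x ≡ false
remove-≡ {x} {av} with x ℕ.≟ x
... | yes _  = refl
... | no x≢x = contradiction refl x≢x

keepBelow-< : ∀ {x av y} → y ℕ.< x → keepBelow x av y ≡ av y
keepBelow-< {x} {av} {y} y<x with y ℕ.<? x
... | yes _  = refl
... | no y≮x = contradiction y<x y≮x

keepBelow-≥ : ∀ {x av y} → x ℕ.≤ y → keepBelow x av y ≡ false
keepBelow-≥ {x} {av} {y} x≤y with y ℕ.<? x
... | yes y<x = contradiction x≤y (ℕ.<⇒≱ y<x)
... | no  _   = refl

count-remove-≤ : ∀ av x → count (remove x av) x ≡ count av x
count-remove-≤ av x = count-cong x (λ i i<x → remove-≢ (ℕ.<⇒≢ i<x))

count-remove-> : ∀ av {x} → av x ≡ true → ∀ j → count av (j ℕ.+ suc x) ≡ suc (count (remove x av) (j ℕ.+ suc x))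
count-remove-> av {x} av-x zero = trans (count-true av av-x)
  (cong suc (sym (trans (count-false (remove x av) {x} (remove-≡ {x} {av})) (count-remove-≤ av x))))
count-remove-> av {x} av-x (suc j) = trans
  (cong₂ (λ b c → (if b then 1 else 0) ℕ.+ c) (sym (remove-≢ {x} {av} (ℕ.>⇒≢ (ℕ.m≤n+m (suc x) j)))) (count-remove-> av av-x j))
  (ℕ.+-suc _ _)

count-remove : ∀ av {x k} → av x ≡ true → x ℕ.< k → count (remove x av) k ∸ count (remove x av) x ≡ count av k ∸ count av (suc x)
count-remove av {x} {k} av-x x<k = trans (cong (count (remove x av) k ∸_) (count-remove-≤ av x))
  (cong₂ _∸_ (sym (subst (λ k → count av k ≡ suc (count (remove x av) k)) (ℕ.m∸n+n≡m x<k) (count-remove-> av av-x (k ∸ suc x)))) (sym (count-true av av-x)))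

count-keepBelow-≤ : ∀ av x {k} → k ℕ.≤ x → count (keepBelow x av) k ≡ count av k
count-keepBelow-≤ av x {k} k≤x = count-cong k (λ i i<k → keepBelow-< (ℕ.<-≤-trans i<k k≤x))

count-keepBelow-≥ : ∀ av x j → count (keepBelow x av) (j ℕ.+ x) ≡ count av x
count-keepBelow-≥ av x zero    = count-keepBelow-≤ av x ℕ.≤-refl
count-keepBelow-≥ av x (suc j) = trans (count-false (keepBelow x av) (keepBelow-≥ {x} {av} (ℕ.m≤n+m x j))) (count-keepBelow-≥ av x j)

module _ {K r M av x} (pre : Prefix r M) (avail : Available K r av) (x<K : x ℕ.< K) (K<M : K ℕ.< M) where

  private
    x-ascent : Ascent r (suc x)
    x-ascent = from (ascents pre) (s≤s z≤n , ℕ.≤-<-trans x<K K<M)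

  -- Without a repeated letter below it, x + 1 starts no rise; it only spends its own second
  -- occurrence, since a larger letter has already followed it.
  available-remove : ¬ Doubled r (suc x) → Available K (suc x ∷ r) (remove x av)
  available-remove ¬doubled = record { legal = legal′ ; illegal = illegal′ }
    where
    legal′ : ∀ {y} → y ℕ.< K → remove x av y ≡ true → ¬ Illegal (suc x ∷ r) (suc y)
    legal′ {y} y<K av-y ill with y ℕ.≟ x
    ... | no y≢x with Illegal-∷⁻ ill
    ...   | inj₁ old                   = legal avail y<K av-y old
    ...   | inj₂ (inj₁ (_ , doubled))  = ¬doubled doubled
    ...   | inj₂ (inj₂ (refl , _))     = y≢x refl
    illegal′ : ∀ {y} → y ℕ.< K → remove x av y ≡ false → Illegal (suc x ∷ r) (suc y)
    illegal′ {y} y<K av-y with y ℕ.≟ x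
    ... | yes refl = inj₂ (from Return-∷ (inj₂ (refl , x-ascent)))
    ... | no  _    = Illegal-weaken (illegal avail y<K av-y)

  -- With a repeated letter below it, x + 1 plays the 2 of 1123. The larger letters become illegal
  -- by this rise, x + 1 itself by its return.
  available-keepBelow : Doubled r (suc x) → Available K (suc x ∷ r) (keepBelow x av)
  available-keepBelow doubled = record { legal = legal′ ; illegal = illegal′ }
    where
    legal′ : ∀ {y} → y ℕ.< K → keepBelow x av y ≡ true → ¬ Illegal (suc x ∷ r) (suc y)
    legal′ {y} y<K av-y ill with y ℕ.<? x
    ... | yes y<x with Illegal-∷⁻ ill
    ...   | inj₁ old                       = legal avail y<K av-y old
    ...   | inj₂ (inj₁ (s≤s x<y , _))      = ℕ.<-asym x<y y<x
    ...   | inj₂ (inj₂ (refl , _))         = ℕ.<-irrefl refl y<x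
    illegal′ : ∀ {y} → y ℕ.< K → keepBelow x av y ≡ false → Illegal (suc x ∷ r) (suc y)
    illegal′ {y} y<K av-y with y ℕ.<? x | ℕ.<-cmp y x
    ... | yes _  | _              = Illegal-weaken (illegal avail y<K av-y)
    ... | no y≮x | tri< y<x _ _   = contradiction y<x y≮x
    ... | no _   | tri≈ _ refl _  = inj₂ (from Return-∷ (inj₂ (refl , x-ascent)))
    ... | no _   | tri> _ _ x<y   = inj₁ (from Rise-∷ (inj₂ (s≤s x<y , doubled)))

available-large : ∀ {K r av z} → Available K r av → K ℕ.< z → Available K (z ∷ r) av
available-large {K} {r} {av} {z} avail K<z = record
  { legal   = legal′
  ; illegal = λ y<K av-y → Illegal-weaken (illegal avail y<K av-y)
  }
  where
  legal′ : ∀ {y} → y ℕ.< K → av y ≡ true → ¬ Illegal (z ∷ r) (suc y)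
  legal′ y<K av-y ill with Illegal-∷⁻ ill
  ... | inj₁ old                = legal avail y<K av-y old
  ... | inj₂ (inj₁ (z<y , _))   = ℕ.<-irrefl refl (ℕ.<-trans (ℕ.<-≤-trans K<z (ℕ.≤-pred z<y)) y<K)
  ... | inj₂ (inj₂ (refl , _))  = ℕ.<-irrefl refl (ℕ.≤-trans K<z y<K)

-- The letters 1, …, K are small, m = K + 1 is the length of the initial run
-- and n = K + 2 is the only further letter that may occur; M is the largest
-- letter read, and l + 1 the smallest letter that has occurred twice.

Unread Read : ℕ → List ℕ → ℕ → Set
Unread K r M = M ≡ suc K
Read   K r M = M ≡ suc (suc K) × Rise r (suc (suc (suc K)))

-- By `Rise-mono`, absence of a rise at n excludes one at m too. No letter above n occurs, so n has
-- no return and its legality is decided by rises alone. The kinds with ° are those with l ≡ K,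
-- where m is the least repeated letter.
data Status (K : ℕ) (r : List ℕ) (M l : ℕ) : Kind → Set where
  none   : Unread K r M ⊎ Read K r M → Illegal r (suc K) → Rise r (suc (suc K)) → l ℕ.< K → Status K r M l none
  onlyₘ  : Unread K r M → ¬ Illegal r (suc K) → Rise r (suc (suc K)) → l ℕ.< K → Status K r M l onlyₘ
  onlyₙ  : Read K r M → Return r (suc K) → ¬ Rise r (suc (suc K)) → l ℕ.< K → Status K r M l onlyₙ
  once   : Read K r M → ¬ Return r (suc K) → ¬ Rise r (suc (suc K)) → l ℕ.< K → Status K r M l once
  both   : Unread K r M → ¬ Return r (suc K) → ¬ Rise r (suc (suc K)) → l ℕ.< K → Status K r M l both
  onlyₙ° : Read K r M → Return r (suc K) → ¬ Rise r (suc (suc K)) → l ≡ K → Status K r M l onlyₙ°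
  once°  : Read K r M → ¬ Return r (suc K) → ¬ Rise r (suc (suc K)) → l ≡ K → Status K r M l once°
  both°  : Unread K r M → ¬ Return r (suc K) → ¬ Rise r (suc (suc K)) → l ≡ K → Status K r M l both°

read? : ∀ {K r M l k} → Status K r M l k → Unread K r M ⊎ Read K r M
read? (none ru _ _ _)   = ru
read? (onlyₘ u _ _ _)   = inj₁ u
read? (onlyₙ rd _ _ _)  = inj₂ rd
read? (once rd _ _ _)   = inj₂ rd
read? (both u _ _ _)    = inj₁ u
read? (onlyₙ° rd _ _ _) = inj₂ rd
read? (once° rd _ _ _)  = inj₂ rd
read? (both° u _ _ _)   = inj₁ u

read-weaken : ∀ {K r M z} → Unread K r M ⊎ Read K r M → Unread K (z ∷ r) M ⊎ Read K (z ∷ r) M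
read-weaken (inj₁ u)           = inj₁ u
read-weaken (inj₂ (eq , rise)) = inj₂ (eq , Rise-weaken rise)

K<M : ∀ {K r M} → Unread K r M ⊎ Read K r M → K ℕ.< M
K<M (inj₁ refl)       = ℕ.≤-refl
K<M (inj₂ (refl , _)) = ℕ.m≤n⇒m≤1+n ℕ.≤-refl

-- By `used`, the least repeated letter, if small, is itself illegal, so `count av K ∸ count av l`
-- counts only letters strictly above it.
record Repeated (K : ℕ) (r : List ℕ) (M l : ℕ) (av : ℕ → Bool) (k : Kind) : Set where
  field
    l≤K       : l ℕ.≤ K
    prefix    : Prefix r M
    doubled   : ∀ {x} → Doubled r x ⇔ suc l ℕ.< x
    available : Available K r av
    used      : l ℕ.< K → av l ≡ false
    status    : Status K r M l k

doubled-first : ∀ {z r} → [ z ] ⊆ r → (∀ {x} → Doubled r x → z ℕ.< x) → ∀ {x} → Doubled (z ∷ r) x ⇔ z ℕ.< x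
doubled-first {z} {r} z∈r above {x} = mk⇔ (λ d → doubled-cases (to Doubled-∷ d)) (λ z<x → from Doubled-∷ (inj₂ (z<x , z∈r)))
  where
  doubled-cases : Doubled r x ⊎ (z ℕ.< x × [ z ] ⊆ r) → z ℕ.< x
  doubled-cases (inj₁ d)         = above d
  doubled-cases (inj₂ (z<x , _)) = z<x

doubled-again : ∀ {z r μ} → (∀ {x} → Doubled r x ⇔ μ ℕ.< x) → μ ℕ.≤ z → ∀ {x} → Doubled (z ∷ r) x ⇔ μ ℕ.< x
doubled-again {z} {r} {μ} doubled μ≤z {x} = mk⇔ (λ d → doubled-cases (to Doubled-∷ d)) (from Doubled-∷ ∘ inj₁ ∘ from doubled)
  where
  doubled-cases : Doubled r x ⊎ (z ℕ.< x × [ z ] ⊆ r) → μ ℕ.< x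
  doubled-cases (inj₁ d)         = to doubled d
  doubled-cases (inj₂ (z<x , _)) = ℕ.≤-<-trans μ≤z z<x

private
  Rise-new : ∀ {z r x} → ¬ Rise r x → ¬ (z ℕ.< x × Doubled r z) → ¬ Rise (z ∷ r) x
  Rise-new ¬old ¬new rise with to Rise-∷ rise
  ... | inj₁ old = ¬old old
  ... | inj₂ new = ¬new new

  Return-new : ∀ {z r x} → ¬ Return r x → ¬ (x ≡ z × Ascent r x) → ¬ Return (z ∷ r) x
  Return-new ¬old ¬new return with to Return-∷ return
  ... | inj₁ old = ¬old old
  ... | inj₂ new = ¬new new

-- A letter with no repeated letter below it starts no rise, and being small it causes no return at
-- m. The conditions on m and n persist; only ° is lost, because a small letter is now the least
-- repeated one.
status-low : ∀ {K r M l k x} → x ℕ.< K → ¬ Doubled r (suc x) → Status K r M l k → Status K (suc x ∷ r) M x (low k)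
status-low {K} {r} {x = x} x<K ¬doubled = λ where
    (none ru ill rise _)            → none (read-weaken ru) (Illegal-weaken ill) (Rise-weaken rise) x<K
    (onlyₘ u ¬ill rise _)           → onlyₘ u (λ { (inj₁ rs) → ¬rise (¬ill ∘ inj₁) rs ; (inj₂ rt) → ¬return (¬ill ∘ inj₂) rt }) (Rise-weaken rise) x<K
    (onlyₙ (eq , rs) rt ¬rs _)      → onlyₙ (eq , Rise-weaken rs) (Return-weaken rt) (¬rise ¬rs) x<K
    (once (eq , rs) ¬rt ¬rs _)      → once (eq , Rise-weaken rs) (¬return ¬rt) (¬rise ¬rs) x<K
    (both u ¬rt ¬rs _)              → both u (¬return ¬rt) (¬rise ¬rs) x<K
    (onlyₙ° (eq , rs) rt ¬rs _)     → onlyₙ (eq , Rise-weaken rs) (Return-weaken rt) (¬rise ¬rs) x<K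
    (once° (eq , rs) ¬rt ¬rs _)     → once (eq , Rise-weaken rs) (¬return ¬rt) (¬rise ¬rs) x<K
    (both° u ¬rt ¬rs _)             → both u (¬return ¬rt) (¬rise ¬rs) x<K
  where
  ¬rise : ∀ {y} → ¬ Rise r y → ¬ Rise (suc x ∷ r) y
  ¬rise ¬rs = Rise-new ¬rs (¬doubled ∘ proj₂)
  ¬return : ¬ Return r (suc K) → ¬ Return (suc x ∷ r) (suc K)
  ¬return ¬rt = Return-new ¬rt (λ { (refl , _) → ℕ.<-irrefl refl x<K })

low-step : ∀ {K r M av k x} → Prefix r M → Available K r av → x ℕ.< K → K ℕ.< M → av x ≡ true →
  (∀ {y} → Doubled r y → suc x ℕ.< y) → Status K (suc x ∷ r) M x k → Repeated K (suc x ∷ r) M x (remove x av) k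
low-step {av = av} {x = x} prefix available x<K K<M av-x above status = record
  { l≤K       = ℕ.<⇒≤ x<K
  ; prefix    = prefix-old prefix (legal available x<K av-x) (s≤s z≤n) x<M
  ; doubled   = doubled-first (from (letters prefix) (s≤s z≤n , x<M)) above
  ; available = available-remove prefix available x<K K<M (ℕ.<-irrefl refl ∘ above)
  ; used      = λ _ → remove-≡ {x} {av}
  ; status    = status
  }
  where x<M = ℕ.<-trans x<K K<M

module _ {K r M l av k} (rep : Repeated K r M l av k) where
  open Repeated rep

  low-next : ∀ {x} → x ℕ.< l → av x ≡ true → Repeated K (suc x ∷ r) M x (remove x av) (low k)
  low-next x<l av-x = low-step prefix available x<K (K<M (read? status)) av-x (λ d → ℕ.<-trans (s≤s x<l) (to doubled d))
    (status-low x<K (λ d → ℕ.<-asym (s≤s x<l) (to doubled d)) status)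
    where x<K = ℕ.<-≤-trans x<l l≤K

  up-next : ∀ {x} → l ℕ.< x → x ℕ.< K → av x ≡ true → Repeated K (suc x ∷ r) M l (keepBelow x av) none
  up-next {x} l<x x<K av-x = record
    { l≤K       = l≤K
    ; prefix    = prefix-old prefix (legal available x<K av-x) (s≤s z≤n) (ℕ.<-trans x<K (K<M (read? status)))
    ; doubled   = doubled-again doubled (s≤s (ℕ.<⇒≤ l<x))
    ; available = available-keepBelow prefix available x<K (K<M (read? status)) x-doubled
    ; used      = λ l<K → trans (keepBelow-< l<x) (used l<K)
    ; status    = none (read-weaken (read? status)) (inj₁ (from Rise-∷ (inj₂ (s≤s x<K , x-doubled))))
                    (from Rise-∷ (inj₂ (s≤s (ℕ.m<n⇒m<1+n x<K) , x-doubled))) (ℕ.<-trans l<x x<K)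
    }
    where
    x-doubled : Doubled r (suc x)
    x-doubled = from doubled (s≤s l<x)

  private
    m n : ℕ
    m = suc K
    n = suc (suc K)

  -- Two questions decide the next state: m returns if and only if n has been read, and it starts a
  -- rise to n if and only if a small letter is repeated.
  m-next : maybe′ (λ k′ → Repeated K (m ∷ r) M l av k′) (Illegal r m) (afterₘ k)
  m-next = go status
    where
    advance : ∀ {k′} → ¬ Illegal r m → Status K (m ∷ r) M l k′ → Repeated K (m ∷ r) M l av k′
    advance ¬ill status′ = record
      { l≤K       = l≤K
      ; prefix    = prefix-old prefix ¬ill (s≤s z≤n) (K<M (read? status))
      ; doubled   = doubled-again doubled (s≤s l≤K)
      ; available = available-large available ℕ.≤-refl
      ; used      = used
      ; status    = status′
      }
    unreturned : M ≡ m → ¬ Return r m → ¬ Return (m ∷ r) m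
    unreturned M≡m ¬rt = Return-new ¬rt (λ (_ , asc) → ℕ.<-irrefl (sym M≡m) (proj₂ (to (ascents prefix) asc)))
    returned : M ≡ n → Return (m ∷ r) m
    returned refl = from Return-∷ (inj₂ (refl , from (ascents prefix) (s≤s z≤n , ℕ.≤-refl)))
    unrisen : ¬ Rise r m → ¬ Rise (m ∷ r) m
    unrisen ¬rs = Rise-new ¬rs (ℕ.<-irrefl refl ∘ proj₁)
    risen : l ℕ.< K → Rise (m ∷ r) n
    risen l<K = from Rise-∷ (inj₂ (ℕ.≤-refl , from doubled (s≤s l<K)))
    unrisen° : l ≡ K → ¬ Rise r n → ¬ Rise (m ∷ r) n
    unrisen° refl ¬rs = Rise-new ¬rs (λ (_ , d) → ℕ.<-irrefl refl (to doubled d))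
    ¬illegal : ¬ Return r m → ¬ Rise r n → ¬ Illegal r m
    ¬illegal ¬rt ¬rs (inj₁ rs) = ¬rs (Rise-mono (ℕ.n≤1+n m) rs)
    ¬illegal ¬rt ¬rs (inj₂ rt) = ¬rt rt
    go : ∀ {k′} → Status K r M l k′ → maybe′ (λ k′ → Repeated K (m ∷ r) M l av k′) (Illegal r m) (afterₘ k′)
    go (none _ ill _ _)              = ill
    go (onlyₘ u ¬ill rs l<K)         = advance ¬ill (onlyₘ u
      (λ { (inj₁ x) → unrisen (¬ill ∘ inj₁) x ; (inj₂ x) → unreturned u (¬ill ∘ inj₂) x }) (Rise-weaken rs) l<K)
    go (onlyₙ _ rt _ _)              = inj₂ rt
    go (once (eq , rs) ¬rt ¬rs l<K)  = advance (¬illegal ¬rt ¬rs) (none (inj₂ (eq , Rise-weaken rs)) (inj₂ (returned eq)) (risen l<K) l<K)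
    go (both u ¬rt ¬rs l<K)          = advance (¬illegal ¬rt ¬rs) (onlyₘ u
      (λ { (inj₁ x) → unrisen (¬rs ∘ Rise-mono (ℕ.n≤1+n m)) x ; (inj₂ x) → unreturned u ¬rt x }) (risen l<K) l<K)
    go (onlyₙ° _ rt _ _)             = inj₂ rt
    go (once° (eq , rs) ¬rt ¬rs l≡K) = advance (¬illegal ¬rt ¬rs) (onlyₙ° (eq , Rise-weaken rs) (returned eq) (unrisen° l≡K ¬rs) l≡K)
    go (both° u ¬rt ¬rs l≡K)         = advance (¬illegal ¬rt ¬rs) (both° u (unreturned u ¬rt) (unrisen° l≡K ¬rs) l≡K)

  n-next : maybe′ (λ k′ → Repeated K (n ∷ r) n l av k′) (Illegal r n) (afterₙ k)
  n-next = go status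
    where
    prefix′ : Unread K r M ⊎ Read K r M → ¬ Illegal r n → Prefix (n ∷ r) n
    prefix′ (inj₁ refl)       ¬ill = prefix-new prefix ¬ill
    prefix′ (inj₂ (refl , _)) ¬ill = prefix-old prefix ¬ill (s≤s z≤n) ℕ.≤-refl
    M≤n : Unread K r M ⊎ Read K r M → M ℕ.≤ n
    M≤n (inj₁ refl)       = ℕ.n≤1+n m
    M≤n (inj₂ (refl , _)) = ℕ.≤-refl
    ¬illegal : ¬ Rise r n → ¬ Illegal r n
    ¬illegal ¬rs (inj₁ rs)              = ¬rs rs
    ¬illegal ¬rs (inj₂ (b , n<b , sub)) = ℕ.<⇒≱ (proj₂ (to (ascents prefix) (b , n<b , ∷ʳ⁻ sub))) (M≤n (read? status))
      where
      ∷ʳ⁻ : ∀ {s} → (n ∷ b ∷ n ∷ []) ⊆ s → (b ∷ n ∷ []) ⊆ s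
      ∷ʳ⁻ (y ∷ʳ p)   = y ∷ʳ ∷ʳ⁻ p
      ∷ʳ⁻ (refl ∷ p) = n ∷ʳ p
    advance : ∀ {k′} → ¬ Rise r n → Status K (n ∷ r) n l k′ → Repeated K (n ∷ r) n l av k′
    advance ¬rs status′ = record
      { l≤K       = l≤K
      ; prefix    = prefix′ (read? status) (¬illegal ¬rs)
      ; doubled   = doubled-again doubled (s≤s (ℕ.m≤n⇒m≤1+n l≤K))
      ; available = available-large available (ℕ.n≤1+n m)
      ; used      = used
      ; status    = status′
      }
    -- The least repeated letter is at most m, so reading n starts a rise that shuts out n + 1.
    read : Read K (n ∷ r) n
    read = refl , from Rise-∷ (inj₂ (ℕ.≤-refl , from doubled (s≤s (s≤s l≤K))))
    unreturned : ¬ Return r m → ¬ Return (n ∷ r) m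
    unreturned ¬rt = Return-new ¬rt (λ (eq , _) → ℕ.<-irrefl eq ℕ.≤-refl)
    unrisen : ¬ Rise r n → ¬ Rise (n ∷ r) n
    unrisen ¬rs = Rise-new ¬rs (ℕ.<-irrefl refl ∘ proj₁)
    go : ∀ {k′} → Status K r M l k′ → maybe′ (λ k′ → Repeated K (n ∷ r) n l av k′) (Illegal r n) (afterₙ k′)
    go (none _ _ rs _)        = inj₁ rs
    go (onlyₘ _ _ rs _)       = inj₁ rs
    go (onlyₙ _ rt ¬rs l<K)   = advance ¬rs (onlyₙ read (Return-weaken rt) (unrisen ¬rs) l<K)
    go (once _ ¬rt ¬rs l<K)   = advance ¬rs (once read (unreturned ¬rt) (unrisen ¬rs) l<K)
    go (both _ ¬rt ¬rs l<K)   = advance ¬rs (once read (unreturned ¬rt) (unrisen ¬rs) l<K)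
    go (onlyₙ° _ rt ¬rs l≡K)  = advance ¬rs (onlyₙ° read (Return-weaken rt) (unrisen ¬rs) l≡K)
    go (once° _ ¬rt ¬rs l≡K)  = advance ¬rs (once° read (unreturned ¬rt) (unrisen ¬rs) l≡K)
    go (both° _ ¬rt ¬rs l≡K)  = advance ¬rs (once° read (unreturned ¬rt) (unrisen ¬rs) l≡K)

illegal-zero : ∀ {z r} M n → Illegal r z → completions (z ∷ r) M n ≡ 0
illegal-zero M n ill = completions-bad M n (from Bad-∷ (inj₂ ill))

completions-repeated : ∀ n {K r M l av k} → Repeated K r M l av k →
  completions r M n ≡ F k (count av l) (count av K ∸ count av l) n
completions-repeated zero    {M = M} rep = completions-zero {M = M} (good (Repeated.prefix rep))
completions-repeated (suc n) {K} {r} {M} {l} {av} {k} rep = trans (completions-suc r M n)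
  (trans (top-letters (read? status))
    (trans (cong₂ ℕ._+_ (n-term (afterₙ k) (n-next rep)) (cong₂ ℕ._+_ (m-term (afterₘ k) (m-next rep)) small-letters))
      (rearrange (tops (afterₙ k)) (tops (afterₘ k)) (sumBelow b (λ i → F none a i n)) (sumLow (λ i j → F (low k) i j n) a b))))
  where
  open Repeated rep
  a = count av l
  b = count av K ∸ count av l
  term : ℕ → ℕ
  term i = completions (suc i ∷ r) (M ⊔ suc i) n
  tops : Maybe Kind → ℕ
  tops = maybe′ (λ k′ → F k′ a b n) 0

  rearrange : ∀ w x y z → w ℕ.+ (x ℕ.+ (y ℕ.+ z)) ≡ z ℕ.+ y ℕ.+ (x ℕ.+ w)
  rearrange = ℕ.+-*-Solver.solve 4 (λ w x y z → w :+ (x :+ (y :+ z)) := z :+ y :+ (x :+ w)) refl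
    where open ℕ.+-*-Solver using (_:+_; _:=_)

  old : ∀ {i} → suc i ℕ.≤ M → ∀ {c} → completions (suc i ∷ r) M n ≡ c → term i ≡ c
  old {i} i<M eq = trans (cong (λ M → completions (suc i ∷ r) M n) (ℕ.m≥n⇒m⊔n≡m i<M)) eq

  M≤n : Unread K r M ⊎ Read K r M → M ⊔ suc (suc K) ≡ suc (suc K)
  M≤n (inj₁ refl)       = ℕ.m≤n⇒m⊔n≡n (ℕ.n≤1+n (suc K))
  M≤n (inj₂ (refl , _)) = ℕ.⊔-idem (suc (suc K))

  -- Index i stands for the letter i + 1, so `term K` belongs to m and `term (suc K)` to n. If n is
  -- unread it is the new letter; otherwise the new letter would be n + 1, which the rise forbids.
  top-letters : Unread K r M ⊎ Read K r M → sumBelow (suc M) term ≡ term (suc K) ℕ.+ (term K ℕ.+ sumBelow K term)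
  top-letters (inj₁ refl)       = refl
  top-letters (inj₂ (refl , rise)) = cong (ℕ._+ (term (suc K) ℕ.+ (term K ℕ.+ sumBelow K term)))
    (illegal-zero (suc (suc K) ⊔ suc (suc (suc K))) n (inj₁ rise))

  n-term : ∀ k? → maybe′ (λ k′ → Repeated K (suc (suc K) ∷ r) (suc (suc K)) l av k′) (Illegal r (suc (suc K))) k? → term (suc K) ≡ tops k?
  n-term nothing  ill  = illegal-zero (M ⊔ suc (suc K)) n ill
  n-term (just k) rep′ = trans (cong (λ M → completions (suc (suc K) ∷ r) M n) (M≤n (read? status))) (completions-repeated n rep′)

  m-term : ∀ k? → maybe′ (λ k′ → Repeated K (suc K ∷ r) M l av k′) (Illegal r (suc K)) k? → term K ≡ tops k?
  m-term nothing  ill  = illegal-zero (M ⊔ suc K) n ill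
  m-term (just k) rep′ = old (K<M (read? status)) (completions-repeated n rep′)

  small : ∀ {i} → i ℕ.< K → suc i ℕ.≤ M
  small i<K = ℕ.<-trans i<K (K<M (read? status))

  low-term : ∀ i → i ℕ.< l → av i ≡ true → term i ≡ F (low k) (count av i) (count av K ∸ count av (suc i)) n
  low-term i i<l av-i = old (small i<K) (trans (completions-repeated n (low-next rep i<l av-i))
    (cong₂ (λ c d → F (low k) c d n) (count-remove-≤ av i) (count-remove av av-i i<K)))
    where i<K = ℕ.<-≤-trans i<l l≤K

  up-term : ∀ i → l ℕ.≤ i → i ℕ.< K → av i ≡ true → term i ≡ F none a (count av i ∸ count av l) n
  up-term i l≤i i<K av-i with ℕ.m≤n⇒m<n∨m≡n l≤i
  ... | inj₂ refl = contradiction (trans (sym av-i) (used i<K)) λ ()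
  ... | inj₁ l<i  = old (small i<K) (trans (completions-repeated n (up-next rep l<i i<K av-i))
    (cong₂ (λ c d → F none c (d ∸ c) n) (count-keepBelow-≤ av i l≤i)
      (subst (λ K → count (keepBelow i av) K ≡ count av i) (ℕ.m∸n+n≡m (ℕ.<⇒≤ i<K)) (count-keepBelow-≥ av i (K ∸ i)))))

  illegal-term : ∀ i → i ℕ.< K → av i ≡ false → term i ≡ 0
  illegal-term i i<K av-i = illegal-zero (M ⊔ suc i) n (illegal available i<K av-i)

  K≡ : K ∸ l ℕ.+ l ≡ K
  K≡ = ℕ.m∸n+n≡m l≤K

  small-letters : sumBelow K term ≡ sumBelow b (λ i → F none a i n) ℕ.+ sumLow (λ i j → F (low k) i j n) a b
  small-letters = trans
    (subst (λ K → sumBelow K term ≡ sumBelow (count av K ∸ count av l) (λ i → F none a i n) ℕ.+ sumBelow l term) K≡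
      (sumBelow-count av K term (λ i → F none a i n) l (K ∸ l)
        (λ i l≤i i< → up-term i l≤i (subst (i ℕ.<_) K≡ i<)) (λ i _ i< → illegal-term i (subst (i ℕ.<_) K≡ i<))))
    (cong (sumBelow b (λ i → F none a i n) ℕ.+_)
      (sumLow-count av K term (λ i j → F (low k) i j n) l l≤K low-term (λ i i<l → illegal-term i (ℕ.<-≤-trans i<l l≤K))))

-- The initial run

record Distinct (r : List ℕ) (M : ℕ) : Set where
  field
    prefix   : Prefix r M
    ¬doubled : ∀ {x} → ¬ Doubled r x
    ¬illegal : ∀ {x} → ¬ Illegal r x

distinct-[] : Distinct [] 0
distinct-[] = record
  { prefix = record
    { good    = λ { (bad₁ _ _ ()) ; (bad₂ _ ()) }
    ; letters = mk⇔ (λ ()) (λ { (s≤s _ , ()) })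
    ; ascents = mk⇔ (λ { (_ , _ , ()) }) (λ { (_ , ()) })
    }
  ; ¬doubled = λ { (_ , _ , ()) }
  ; ¬illegal = λ { (inj₁ (_ , _ , _ , _ , ())) ; (inj₂ (_ , _ , ())) }
  }

distinct-∷ : ∀ {r M} → Distinct r M → Distinct (suc M ∷ r) (suc M)
distinct-∷ {r} {M} dist = record
  { prefix   = prefix-new prefix ¬illegal
  ; ¬doubled = λ d → no-doubled (to Doubled-∷ d)
  ; ¬illegal = λ ill → no-illegal (Illegal-∷⁻ ill)
  }
  where
  open Distinct dist
  no-doubled : ∀ {x} → ¬ (Doubled r x ⊎ (suc M ℕ.< x × [ suc M ] ⊆ r))
  no-doubled (inj₁ d)         = ¬doubled d
  no-doubled (inj₂ (_ , sub)) = ℕ.<-irrefl refl (proj₂ (to (letters prefix) sub))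
  no-illegal : ∀ {x} → ¬ (Illegal r x ⊎ (suc M ℕ.< x × Doubled r (suc M)) ⊎ (x ≡ suc M × Ascent r x))
  no-illegal (inj₁ ill)                 = ¬illegal ill
  no-illegal (inj₂ (inj₁ (_ , d)))      = ¬doubled d
  no-illegal (inj₂ (inj₂ (refl , asc))) = ℕ.<⇒≱ (proj₂ (to (ascents prefix) asc)) (ℕ.n≤1+n M)

private
  all : ℕ → Bool
  all _ = true

  count-all : ∀ k → count all k ≡ k
  count-all zero    = refl
  count-all (suc k) = cong suc (count-all k)

-- The run either grows or ends with the first repeated letter. If that is m, all a small letters
-- remain legal below it; if it is small, it splits the others into those below and those above.
completions-distinct : ∀ n {a r} → Distinct r (suc a) → completions r (suc a) n ≡ initialRun a n
completions-distinct zero {a} dist = completions-zero {M = suc a} (good (Distinct.prefix dist))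
completions-distinct (suc n) {a} {r} dist = trans (completions-suc r m n) (cong₂ ℕ._+_
  (trans (cong (λ M → completions (suc m ∷ r) M n) (ℕ.m≤n⇒m⊔n≡n (ℕ.n≤1+n m))) (completions-distinct n (distinct-∷ dist)))
  (trans (cong₂ ℕ._+_ m-term small-letters) (ℕ.+-comm (F both° a 0 n) _)))
  where
  open Distinct dist
  m = suc a
  term : ℕ → ℕ
  term i = completions (suc i ∷ r) (m ⊔ suc i) n

  old : ∀ {i} → suc i ℕ.≤ m → ∀ {c} → completions (suc i ∷ r) m n ≡ c → term i ≡ c
  old {i} i<m eq = trans (cong (λ M → completions (suc i ∷ r) M n) (ℕ.m≥n⇒m⊔n≡m i<m)) eq

  available : Available a r all
  available = record { legal = λ _ _ → ¬illegal ; illegal = λ _ () }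

  ¬rise : ∀ {z x} → ¬ Rise (z ∷ r) x
  ¬rise rise with to Rise-∷ rise
  ... | inj₁ rs      = ¬illegal (inj₁ rs)
  ... | inj₂ (_ , d) = ¬doubled d

  ¬return-m : ∀ {z} → ¬ Return (z ∷ r) m
  ¬return-m rt with to Return-∷ rt
  ... | inj₁ rt′     = ¬illegal (inj₂ rt′)
  ... | inj₂ (_ , asc) = ℕ.<-irrefl refl (proj₂ (to (ascents prefix) asc))

  m-term : term a ≡ F both° a 0 n
  m-term = old ℕ.≤-refl (trans (completions-repeated n repeated)
    (cong₂ (λ c d → F both° c d n) (count-all a) (ℕ.n∸n≡0 (count all a))))
    where
    repeated : Repeated a (m ∷ r) m a all both°
    repeated = record
      { l≤K       = ℕ.≤-refl
      ; prefix    = prefix-old prefix ¬illegal (s≤s z≤n) ℕ.≤-refl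
      ; doubled   = doubled-first (from (letters prefix) (s≤s z≤n , ℕ.≤-refl)) (λ d → contradiction d ¬doubled)
      ; available = available-large available ℕ.≤-refl
      ; used      = λ a<a → contradiction a<a (ℕ.<-irrefl refl)
      ; status    = both° refl ¬return-m ¬rise refl
      }

  low-term : ∀ i → i ℕ.< a → all i ≡ true → term i ≡ F both (count all i) (count all a ∸ count all (suc i)) n
  low-term i i<a _ = old (ℕ.m<n⇒m<1+n i<a) (trans
    (completions-repeated n (low-step prefix available i<a ℕ.≤-refl refl (λ d → contradiction d ¬doubled) (both refl ¬return-m ¬rise i<a)))
    (cong₂ (λ c d → F both c d n) (count-remove-≤ all i) (count-remove all refl i<a)))

  small-letters : sumBelow a term ≡ sumLow (λ i j → F both i j n) a 0
  small-letters = trans (sumLow-count all a term (λ i j → F both i j n) a ℕ.≤-refl low-term (λ _ _ ()))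
    (cong₂ (sumLow (λ i j → F both i j n)) (count-all a) (ℕ.n∸n≡0 (count all a)))

p-suc : ∀ n → p (suc n) patterns ≡ initialRun 0 n
p-suc n = trans (completions-suc [] 0 n) (trans (ℕ.+-identityʳ _) (completions-distinct n (distinct-∷ distinct-[])))

-- The ring of power series

module _ where
  open ℚ.+-*-Solver

  infix 8 neg_
  neg_ : Series → Series
  (neg f) n = ℚ.- f n

  -- By definition the coefficient of degree n + 1 of f * g is f 0 times g (n + 1) plus the
  -- coefficient of degree n of (f ∘ suc) * g. This makes the ring laws provable by induction on the
  -- degree, with f replaced by its tail.
  *-congₛ : ∀ {f f′ g g′} → f ≗ f′ → g ≗ g′ → f * g ≗ f′ * g′
  *-congₛ f≗ g≗ zero    = cong₂ (λ x y → x ℚ.* y ℚ.+ 0ℚ) (f≗ 0) (g≗ 0)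
  *-congₛ f≗ g≗ (suc n) = cong₂ ℚ._+_ (cong₂ ℚ._*_ (f≗ 0) (g≗ (suc n))) (*-congₛ (f≗ ∘ suc) g≗ n)

  *-suc′ : ∀ f g n → (f * g) (suc n) ≡ f (suc n) ℚ.* g 0 ℚ.+ (f * (g ∘ suc)) n
  *-suc′ f g zero    = solve 4 (λ a b c d → a :* b :+ (c :* d :+ con 0ℚ) := c :* d :+ (a :* b :+ con 0ℚ)) refl (f 0) (g 1) (f 1) (g 0)
  *-suc′ f g (suc n) = trans
    (cong (f 0 ℚ.* g (suc (suc n)) ℚ.+_) (*-suc′ (f ∘ suc) g n))
    (solve 3 (λ x y z → x :+ (y :+ z) := y :+ (x :+ z)) refl
      (f 0 ℚ.* g (suc (suc n))) (f (suc (suc n)) ℚ.* g 0) (((f ∘ suc) * (g ∘ suc)) n))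

  *-commₛ : ∀ f g → f * g ≗ g * f
  *-commₛ f g zero    = cong (ℚ._+ 0ℚ) (ℚ.*-comm (f 0) (g 0))
  *-commₛ f g (suc n) = trans (cong₂ ℚ._+_ (ℚ.*-comm (f 0) (g (suc n))) (*-commₛ (f ∘ suc) g n)) (sym (*-suc′ g f n))

  *-distribʳₛ : ∀ h f g → (f + g) * h ≗ f * h + g * h
  *-distribʳₛ h f g zero    = solve 3 (λ f g h → (f :+ g) :* h :+ con 0ℚ := (f :* h :+ con 0ℚ) :+ (g :* h :+ con 0ℚ)) refl (f 0) (g 0) (h 0)
  *-distribʳₛ h f g (suc n) = trans
    (cong ((f 0 ℚ.+ g 0) ℚ.* h (suc n) ℚ.+_) (*-distribʳₛ h (f ∘ suc) (g ∘ suc) n))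
    (solve 5 (λ f g h x y → (f :+ g) :* h :+ (x :+ y) := (f :* h :+ x) :+ (g :* h :+ y)) refl
      (f 0) (g 0) (h (suc n)) (((f ∘ suc) * h) n) (((g ∘ suc) * h) n))

  scale-* : ∀ c f g → (λ n → c ℚ.* f n) * g ≗ λ n → c ℚ.* (f * g) n
  scale-* c f g zero    = solve 3 (λ c f g → (c :* f) :* g :+ con 0ℚ := c :* (f :* g :+ con 0ℚ)) refl c (f 0) (g 0)
  scale-* c f g (suc n) = trans
    (cong ((c ℚ.* f 0) ℚ.* g (suc n) ℚ.+_) (scale-* c (f ∘ suc) g n))
    (solve 4 (λ c f g x → (c :* f) :* g :+ c :* x := c :* (f :* g :+ x)) refl c (f 0) (g (suc n)) (((f ∘ suc) * g) n))

  *-assocₛ : ∀ f g h → (f * g) * h ≗ f * (g * h)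
  *-assocₛ f g h zero    = solve 3 (λ f g h → (f :* g :+ con 0ℚ) :* h :+ con 0ℚ := f :* (g :* h :+ con 0ℚ) :+ con 0ℚ) refl (f 0) (g 0) (h 0)
  *-assocₛ f g h (suc n) = begin
    (f₀ ℚ.* g₀ ℚ.+ 0ℚ) ℚ.* hₙ ℚ.+ (((λ k → f₀ ℚ.* g (suc k)) + (f ∘ suc) * g) * h) n
      ≡⟨ cong ((f₀ ℚ.* g₀ ℚ.+ 0ℚ) ℚ.* hₙ ℚ.+_) (*-distribʳₛ h (λ k → f₀ ℚ.* g (suc k)) ((f ∘ suc) * g) n) ⟩
    (f₀ ℚ.* g₀ ℚ.+ 0ℚ) ℚ.* hₙ ℚ.+ (((λ k → f₀ ℚ.* g (suc k)) * h) n ℚ.+ (((f ∘ suc) * g) * h) n)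
      ≡⟨ cong₂ (λ x y → (f₀ ℚ.* g₀ ℚ.+ 0ℚ) ℚ.* hₙ ℚ.+ (x ℚ.+ y)) (scale-* f₀ (g ∘ suc) h n) (*-assocₛ (f ∘ suc) g h n) ⟩
    (f₀ ℚ.* g₀ ℚ.+ 0ℚ) ℚ.* hₙ ℚ.+ (f₀ ℚ.* ((g ∘ suc) * h) n ℚ.+ ((f ∘ suc) * (g * h)) n)
      ≡⟨ solve 5 (λ f g h x y → (f :* g :+ con 0ℚ) :* h :+ (f :* x :+ y) := f :* (g :* h :+ x) :+ y) refl f₀ g₀ hₙ (((g ∘ suc) * h) n) (((f ∘ suc) * (g * h)) n) ⟩
    f₀ ℚ.* (g₀ ℚ.* hₙ ℚ.+ ((g ∘ suc) * h) n) ℚ.+ ((f ∘ suc) * (g * h)) n ∎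
    where
    open ≡-Reasoning
    f₀ = f 0
    g₀ = g 0
    hₙ = h (suc n)

  0*ₛ : ∀ f → (λ _ → 0ℚ) * f ≗ λ _ → 0ℚ
  0*ₛ f zero    = cong (ℚ._+ 0ℚ) (ℚ.*-zeroˡ (f 0))
  0*ₛ f (suc n) = cong₂ ℚ._+_ (ℚ.*-zeroˡ (f (suc n))) (0*ₛ f n)

  constant-* : ∀ c f → constant c * f ≗ λ n → c ℚ.* f n
  constant-* c f zero    = ℚ.+-identityʳ (c ℚ.* f 0)
  constant-* c f (suc n) = trans (cong (c ℚ.* f (suc n) ℚ.+_) (0*ₛ f n)) (ℚ.+-identityʳ _)

  1*ₛ : ∀ f → constant 1ℚ * f ≗ f
  1*ₛ f n = trans (constant-* 1ℚ f n) (ℚ.*-identityˡ (f n))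

0ₛ : Series
0ₛ = constant 0ℚ

0ₛ-lookup : ∀ n → 0ₛ n ≡ 0ℚ
0ₛ-lookup zero    = refl
0ₛ-lookup (suc _) = refl

-- A record, so that comparing two equations does not unfold the convolutions
-- on their sides.

infix 4 _≋_

record _≋_ (f g : Series) : Set where
  constructor pointwise
  field at : f ≗ g

open _≋_

isCommutativeRing : IsCommutativeRing _≋_ _+_ _*_ neg_ 0ₛ (constant 1ℚ)
isCommutativeRing = record
  { isRing = record
    { +-isAbelianGroup = record
      { isGroup = record
        { isMonoid = record
          { isSemigroup = record
            { isMagma = record
              { isEquivalence = record
                { refl  = pointwise λ _ → refl
                ; sym   = λ p → pointwise λ n → sym (at p n)
                ; trans = λ p q → pointwise λ n → trans (at p n) (at q n)
                }
              ; ∙-cong = λ p q → pointwise λ n → cong₂ ℚ._+_ (at p n) (at q n)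
              }
            ; assoc = λ f g h → pointwise λ n → ℚ.+-assoc (f n) (g n) (h n)
            }
          ; identity = (λ f → pointwise λ n → trans (cong (ℚ._+ f n) (0ₛ-lookup n)) (ℚ.+-identityˡ (f n)))
                     , (λ f → pointwise λ n → trans (cong (f n ℚ.+_) (0ₛ-lookup n)) (ℚ.+-identityʳ (f n)))
          }
        ; inverse = (λ f → pointwise λ n → trans (ℚ.+-inverseˡ (f n)) (sym (0ₛ-lookup n)))
                  , (λ f → pointwise λ n → trans (ℚ.+-inverseʳ (f n)) (sym (0ₛ-lookup n)))
        ; ⁻¹-cong = λ p → pointwise λ n → cong ℚ.-_ (at p n)
        }
      ; comm = λ f g → pointwise λ n → ℚ.+-comm (f n) (g n)
      }
    ; *-cong = λ p q → pointwise (*-congₛ (at p) (at q))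
    ; *-assoc = λ f g h → pointwise (*-assocₛ f g h)
    ; *-identity = (λ f → pointwise (1*ₛ f))
                 , λ f → pointwise λ n → trans (*-commₛ f (constant 1ℚ) n) (1*ₛ f n)
    ; distrib = (λ h f g → pointwise λ n → trans (*-commₛ h (f + g) n) (trans (*-distribʳₛ h f g n)
                    (cong₂ ℚ._+_ (*-commₛ f h n) (*-commₛ g h n))))
              , λ h f g → pointwise (*-distribʳₛ h f g)
    }
  ; *-comm = λ f g → pointwise (*-commₛ f g)
  }

seriesRing : CommutativeRing 0ℓ 0ℓ
seriesRing = record { isCommutativeRing = isCommutativeRing }

fromℤ-+ : ∀ a b → fromℤ (a ℤ.+ b) ≡ fromℤ a ℚ.+ fromℤ b
fromℤ-+ a b = ℚ.toℚᵘ-injective (ℚᵘ.≃-trans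
  (ℚᵘ.*≡* (cong (ℤ._* + 1) (sym (cong₂ ℤ._+_ (ℤ.*-identityʳ a) (ℤ.*-identityʳ b)))))
  (ℚᵘ.≃-sym (ℚ.toℚᵘ-homo-+ (fromℤ a) (fromℤ b))))

fromℤ-* : ∀ a b → fromℤ (a ℤ.* b) ≡ fromℤ a ℚ.* fromℤ b
fromℤ-* a b = ℚ.toℚᵘ-injective (ℚᵘ.≃-sym (ℚ.toℚᵘ-homo-* (fromℤ a) (fromℤ b)))

fromℤ-neg : ∀ a → fromℤ (ℤ.- a) ≡ ℚ.- fromℤ a
fromℤ-neg a = ℚ.toℚᵘ-injective (ℚᵘ.≃-sym (ℚ.toℚᵘ-homo‿- (fromℤ a)))

-- All polynomial identities below have integer coefficients, whose equality is decidable, unlike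
-- that of series.
fromℤ-homomorphism : CommutativeRing.rawRing ℤ.+-*-commutativeRing -Raw-AlmostCommutative⟶ fromCommutativeRing seriesRing
fromℤ-homomorphism = record
  { ⟦_⟧    = λ z → constant (fromℤ z)
  ; +-homo = λ a b → pointwise λ { zero → fromℤ-+ a b ; (suc n) → sym (ℚ.+-identityˡ 0ℚ) }
  ; *-homo = λ a b → pointwise λ
      { zero    → trans (fromℤ-* a b) (sym (constant-* (fromℤ a) (constant (fromℤ b)) 0))
      ; (suc n) → trans (sym (ℚ.*-zeroʳ (fromℤ a))) (sym (constant-* (fromℤ a) (constant (fromℤ b)) (suc n)))
      }
  ; -‿homo = λ a → pointwise λ { zero → fromℤ-neg a ; (suc n) → refl }
  ; 0-homo = pointwise λ { zero → refl ; (suc n) → refl }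
  ; 1-homo = pointwise λ { zero → refl ; (suc n) → refl }
  }

≟-constant : ∀ a b → Maybe (constant (fromℤ a) ≋ constant (fromℤ b))
≟-constant a b with a ℤ.≟ b
... | yes refl = just (pointwise λ _ → refl)
... | no _     = nothing

private module Solver = Algebra.Solver.Ring (CommutativeRing.rawRing ℤ.+-*-commutativeRing) (fromCommutativeRing seriesRing) fromℤ-homomorphism ≟-constant
open Solver using (solve; _:+_; _:*_; _:-_; _:^_; con; _:=_; :-_)

num : ℕ → Series
num n = constant (fromℤ (+ n))

-- Generating functions

open CommutativeRing seriesRing using (+-cong; +-congˡ; *-congˡ) renaming (refl to ≋-refl; sym to ≋-sym; trans to ≋-trans)
private module Additive = Algebra.Properties.Group (CommutativeRing.+-group seriesRing)

t*-zero : ∀ f → (t * f) 0 ≡ 0ℚ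
t*-zero f = cong (ℚ._+ 0ℚ) (ℚ.*-zeroˡ (f 0))

t*-suc : ∀ f n → (t * f) (suc n) ≡ f n
t*-suc f n = trans (cong₂ ℚ._+_ (ℚ.*-zeroˡ (f (suc n))) (trans (*-congₛ {g = f} t∘suc (λ _ → refl) n) (1*ₛ f n)))
                   (ℚ.+-identityˡ (f n))
  where
  t∘suc : t ∘ suc ≗ constant 1ℚ
  t∘suc zero    = refl
  t∘suc (suc _) = refl

t*-agree-zero : ∀ f g → (t * f) 0 ≡ (t * g) 0
t*-agree-zero f g = trans (t*-zero f) (sym (t*-zero g))

t*-agree-suc : ∀ f g n → f n ≡ g n → (t * f) (suc n) ≡ (t * g) (suc n)
t*-agree-suc f g n eq = trans (t*-suc f n) (trans eq (sym (t*-suc g n)))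

-- To deduce f ≋ g from h ≋ k, exhibit f − g as a multiple of h − k;
-- the certificate is stated without subtraction.
by-multiple : ∀ {f g h k} c → h ≋ k → f + c * k ≋ g + c * h → f ≋ g
by-multiple {f} {g} {h} {k} c h≋k eq = Additive.∙-cancelʳ (c * k) f g (≋-trans eq (+-congˡ {g} (*-congˡ {c} h≋k)))

*-cancel-unit : ∀ {u a f g} → u * a ≋ num 1 → a * f ≋ a * g → f ≋ g
-- The certificate is f - g = (f - g)(1 - u a) + u (a f - a g).
*-cancel-unit {u} {a} {f} {g} ua≋1 eq = by-multiple (f - g) (≋-sym ua≋1) (by-multiple u eq
  (solve 4 (λ u a f g → f :+ (f :- g) :* (u :* a) :+ u :* (a :* g) := g :+ (f :- g) :* con (+ 1) :+ u :* (a :* f)) ≋-refl u a f g))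

-- hat F = Σₐ tᵃ Fₐ
hat : (ℕ → Series) → Series
hat F zero    = F 0 0
hat F (suc n) = F 0 (suc n) ℚ.+ hat (F ∘ suc) n

hat-unfold : ∀ F → hat F ≋ F 0 + t * hat (F ∘ suc)
at (hat-unfold F) zero    = sym (trans (cong (F 0 0 ℚ.+_) (t*-zero (hat (F ∘ suc)))) (ℚ.+-identityʳ (F 0 0)))
at (hat-unfold F) (suc n) = cong (F 0 (suc n) ℚ.+_) (sym (t*-suc (hat (F ∘ suc)) n))

hat-cong : ∀ {F G} → (∀ a → F a ≋ G a) → hat F ≋ hat G
at (hat-cong F≋G) zero    = at (F≋G 0) 0
at (hat-cong F≋G) (suc n) = cong₂ ℚ._+_ (at (F≋G 0) (suc n)) (at (hat-cong (F≋G ∘ suc)) n)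

-- Unrolling the recursion k times leaves a remainder divisible by tᵏ, which does not reach the
-- coefficients below degree k.
hat-unique : ∀ {F S : ℕ → Series} → (∀ a → S a ≋ F a + t * S (suc a)) → S 0 ≋ hat F
at (hat-unique {F} {S} eq) zero    = trans (at (eq 0) 0) (trans (cong (F 0 0 ℚ.+_) (t*-zero (S 1))) (ℚ.+-identityʳ (F 0 0)))
at (hat-unique {F} {S} eq) (suc n) = trans (at (eq 0) (suc n)) (cong (F 0 (suc n) ℚ.+_) (trans (t*-suc (S 1) n) (at (hat-unique (eq ∘ suc)) n)))

hat-+ : ∀ F G → hat (λ a → F a + G a) ≋ hat F + hat G
at (hat-+ F G) zero    = refl
at (hat-+ F G) (suc n) = trans (cong (F 0 (suc n) ℚ.+ G 0 (suc n) ℚ.+_) (at (hat-+ (F ∘ suc) (G ∘ suc)) n))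
  (interchange (F 0 (suc n)) (G 0 (suc n)) (hat (F ∘ suc) n) (hat (G ∘ suc) n))
  where open Algebra.Properties.CommutativeSemigroup (CommutativeRing.+-commutativeSemigroup ℚ.+-*-commutativeRing) using (interchange)

hat-* : ∀ f F → hat (λ a → f * F a) ≋ f * hat F
at (hat-* f F) zero    = refl
at (hat-* f F) (suc n) = trans (at (hat-unfold (λ a → f * F a)) (suc n)) (trans
    (cong ((f * F 0) (suc n) ℚ.+_) (trans (t*-suc (hat (λ a → f * F (suc a))) n) (trans (at (hat-* f (F ∘ suc)) n)
      (sym (t*-suc (f * hat (F ∘ suc)) n)))))
    (at (≋-trans (solve 4 (λ f F t H → f :* F :+ t :* (f :* H) := f :* (F :+ t :* H)) ≋-refl f (F 0) t (hat (F ∘ suc)))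
      (*-congˡ {f} (≋-sym (hat-unfold F)))) (suc n)))

geometric : Series → Series
geometric f = hat (f ^_)

geometric-inverse : ∀ f → (num 1 - t * f) * geometric f ≋ num 1
geometric-inverse f = by-multiple (num 1) eq (solve 3 (λ t f v →
   (con (+ 1) :- t :* f) :* v :+ con (+ 1) :* (con (+ 1) :+ t :* (f :* v)) := con (+ 1) :+ con (+ 1) :* v) ≋-refl t f (geometric f))
  where
  eq : geometric f ≋ num 1 + t * (f * geometric f)
  eq = ≋-trans (hat-unfold (f ^_)) (+-congˡ {num 1} (*-congˡ {t} (hat-* f (f ^_))))

-- ρ = C(t²/(1 − t)) for the Catalan series C, read off from √Δ = 1 − t − 2 t² ρ.

√Δ : Series
√Δ = √ ((num 1 - t) * (num 1 - t - num 4 * t ^ 2))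

ρ : Series
ρ n = ½ ℚ.* (num 1 - t - √Δ) (suc (suc n))

t²ρ : num 2 * t ^ 2 * ρ ≋ num 1 - t - √Δ
-- 1 - t - √Δ has no terms below degree 2, so the shift by two in `ρ` loses nothing.
at t²ρ zero = refl
at t²ρ (suc zero) = refl
at t²ρ (suc (suc n)) = trans
  (at (solve 2 (λ t ρ → con (+ 2) :* t :^ 2 :* ρ := t :* (t :* (con (+ 2) :* ρ))) ≋-refl t ρ) (suc (suc n)))
  (trans (t*-suc (t * (num 2 * ρ)) (suc n)) (trans (t*-suc (num 2 * ρ) n) (trans (constant-* (fromℤ (+ 2)) ρ n)
    (trans (sym (ℚ.*-assoc (fromℤ (+ 2)) ½ ((num 1 - t - √Δ) (suc (suc n))))) (ℚ.*-identityˡ _)))))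

*-cancel-4t² : ∀ {f g} → num 4 * t ^ 2 * f ≋ num 4 * t ^ 2 * g → f ≋ g
at (*-cancel-4t² {f} {g} eq) n = conclude (coefficient f) (at eq (suc (suc n))) (coefficient g)
  where
  coefficient : ∀ h → (num 4 * t ^ 2 * h) (suc (suc n)) ≡ fromℤ (+ 4) ℚ.* h n
  coefficient h = trans (at (solve 2 (λ t h → con (+ 4) :* t :^ 2 :* h := t :* (t :* (con (+ 4) :* h))) ≋-refl t h) (suc (suc n)))
    (trans (t*-suc (t * (num 4 * h)) (suc n)) (trans (t*-suc (num 4 * h) n) (constant-* (fromℤ (+ 4)) h n)))
  quarter : ∀ x → (½ ℚ.* ½) ℚ.* (fromℤ (+ 4) ℚ.* x) ≡ x
  quarter x = trans (sym (ℚ.*-assoc (½ ℚ.* ½) (fromℤ (+ 4)) x)) (ℚ.*-identityˡ x)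
  conclude : ∀ {x y x′ y′} → x ≡ fromℤ (+ 4) ℚ.* x′ → x ≡ y → y ≡ fromℤ (+ 4) ℚ.* y′ → x′ ≡ y′
  conclude {x′ = x′} {y′} p q r = trans (sym (quarter x′)) (trans (cong ((½ ℚ.* ½) ℚ.*_) (trans (sym p) (trans q r))) (quarter y′))

√Δ² : √Δ * √Δ ≋ (num 1 - t) * (num 1 - t - num 4 * t ^ 2)
√Δ² = pointwise (√-square ((num 1 - t) * (num 1 - t - num 4 * t ^ 2)) refl)

-- This is (1 - t - 2 t² ρ)² = Δ divided by 4 t².
ρ-quadratic : t ^ 2 * ρ ^ 2 + (num 1 - t) ≋ (num 1 - t) * ρ
ρ-quadratic = *-cancel-4t² (by-multiple (num 1) √Δ² (by-multiple (num 2 * t ^ 2 * ρ - (num 1 - t) - √Δ) t²ρ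
  (solve 3 (λ t ρ s → let a = con (+ 1) :- t; y = con (+ 2) :* t :^ 2 :* ρ ; c = y :- a :- s in
     con (+ 4) :* t :^ 2 :* (t :^ 2 :* ρ :^ 2 :+ a) :+ con (+ 1) :* (a :* (a :- con (+ 4) :* t :^ 2)) :+ c :* (a :- s)
     := con (+ 4) :* t :^ 2 :* (a :* ρ) :+ con (+ 1) :* (s :* s) :+ c :* y) ≋-refl t ρ √Δ)))

u v r : Series
u = geometric (num 1)
v = geometric ρ
r = num 1 + t * ρ

u-inverse : u * (num 1 - t) ≋ num 1
u-inverse = ≋-trans (solve 2 (λ t u → u :* (con (+ 1) :- t) := (con (+ 1) :- t :* con (+ 1)) :* u) ≋-refl t u) (geometric-inverse (num 1))

v-inverse : (num 1 - t * ρ) * v ≋ num 1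
v-inverse = geometric-inverse ρ

-- The last factor is 1 - t r, so u ρ is the sum of the geometric series with ratio t r.
uρ-inverse : u * ρ * (num 1 - t - t ^ 2 * ρ) ≋ num 1
uρ-inverse = by-multiple u (≋-sym ρ-quadratic) (by-multiple (num 1) u-inverse
  (solve 3 (λ t ρ u → let a = con (+ 1) :- t in
     u :* ρ :* (a :- t :^ 2 :* ρ) :+ u :* (t :^ 2 :* ρ :^ 2 :+ a) :+ con (+ 1) :* con (+ 1)
     := con (+ 1) :+ u :* (a :* ρ) :+ con (+ 1) :* (u :* a)) ≋-refl t ρ u))

-- Linear recurrences

module _ {P Y Z P′ Y′ Z′ : ℕ → Series} where

  -- The factors t make degree n + 1 depend only on degree n, and Z b is a finite sum of values of
  -- P. The induction on n treats all b together because Y b refers to Y (b + 1).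
  unique₁ : ∀ {c : Series} →
    (∀ b → P b ≋ c + t * (Y b + Z b)) → (∀ b → Y b ≋ t * (P b + Y (suc b))) →
    Z 0 ≋ 0ₛ → (∀ b → Z (suc b) ≋ P b + Z b) →
    (∀ b → P′ b ≋ c + t * (Y′ b + Z′ b)) → (∀ b → Y′ b ≋ t * (P′ b + Y′ (suc b))) →
    Z′ 0 ≋ 0ₛ → (∀ b → Z′ (suc b) ≋ P′ b + Z′ b) →
    ∀ n b → P b n ≡ P′ b n × Y b n ≡ Y′ b n
  unique₁ {c} P-eq Y-eq Z-zero Z-suc P′-eq Y′-eq Z′-zero Z′-suc = go
    where
    go : ∀ n b → P b n ≡ P′ b n × Y b n ≡ Y′ b n
    go-Z : ∀ n b → Z b n ≡ Z′ b n
    level : ∀ n b → (t * (Y b + Z b)) n ≡ (t * (Y′ b + Z′ b)) n → (t * (P b + Y (suc b))) n ≡ (t * (P′ b + Y′ (suc b))) n →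
           P b n ≡ P′ b n × Y b n ≡ Y′ b n
    level n b eq₁ eq₂ = trans (at (P-eq b) n) (trans (cong (c n ℚ.+_) eq₁) (sym (at (P′-eq b) n)))
                     , trans (at (Y-eq b) n) (trans eq₂ (sym (at (Y′-eq b) n)))
    go zero    b = level 0 b (t*-agree-zero (Y b + Z b) (Y′ b + Z′ b)) (t*-agree-zero (P b + Y (suc b)) (P′ b + Y′ (suc b)))
    go (suc n) b = level (suc n) b
      (t*-agree-suc (Y b + Z b) (Y′ b + Z′ b) n (cong₂ ℚ._+_ (proj₂ (go n b)) (go-Z n b)))
      (t*-agree-suc (P b + Y (suc b)) (P′ b + Y′ (suc b)) n (cong₂ ℚ._+_ (proj₁ (go n b)) (proj₂ (go n (suc b)))))
    go-Z n zero    = trans (at Z-zero n) (sym (at Z′-zero n))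
    go-Z n (suc b) = trans (at (Z-suc b) n) (trans (cong₂ ℚ._+_ (proj₁ (go n b)) (go-Z n b)) (sym (at (Z′-suc b) n)))

module _ {X Y X′ Y′ : ℕ → Series} where

  -- In the applications e is 1 or 0, according to whether one of the letters m and n leaves the
  -- kind unchanged.
  unique₂ : ∀ {c : ℕ → Series} {e} →
    (∀ b → X b ≋ c b + t * (Y b + constant e * X b)) → (∀ b → Y b ≋ t * (X b + Y (suc b))) →
    (∀ b → X′ b ≋ c b + t * (Y′ b + constant e * X′ b)) → (∀ b → Y′ b ≋ t * (X′ b + Y′ (suc b))) →
    ∀ n b → X b n ≡ X′ b n × Y b n ≡ Y′ b n
  unique₂ {c} {e} X-eq Y-eq X′-eq Y′-eq = go
    where
    go : ∀ n b → X b n ≡ X′ b n × Y b n ≡ Y′ b n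
    level : ∀ n b → (t * (Y b + constant e * X b)) n ≡ (t * (Y′ b + constant e * X′ b)) n →
           (t * (X b + Y (suc b))) n ≡ (t * (X′ b + Y′ (suc b))) n → X b n ≡ X′ b n × Y b n ≡ Y′ b n
    level n b eq₁ eq₂ = trans (at (X-eq b) n) (trans (cong (c b n ℚ.+_) eq₁) (sym (at (X′-eq b) n)))
                     , trans (at (Y-eq b) n) (trans eq₂ (sym (at (Y′-eq b) n)))
    go zero    b = level 0 b (t*-agree-zero (Y b + constant e * X b) (Y′ b + constant e * X′ b)) (t*-agree-zero (X b + Y (suc b)) (X′ b + Y′ (suc b)))
    go (suc n) b = level (suc n) b
      (t*-agree-suc (Y b + constant e * X b) (Y′ b + constant e * X′ b) n (cong₂ ℚ._+_ (proj₂ (go n b)) loop))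
      (t*-agree-suc (X b + Y (suc b)) (X′ b + Y′ (suc b)) n (cong₂ ℚ._+_ (proj₁ (go n b)) (proj₂ (go n (suc b)))))
      where
      loop : (constant e * X b) n ≡ (constant e * X′ b) n
      loop = trans (constant-* e (X b) n) (trans (cong (e ℚ.*_) (proj₁ (go n b))) (sym (constant-* e (X′ b) n)))

private
  -- Inserting Y b = y rᵇ forces y = t x / (1 - t r), whose reciprocal factor is u ρ.
  geometric-Y : ∀ x b → t * u * ρ * x * r ^ b ≋ t * (x * r ^ b + t * u * ρ * x * r ^ suc b)
  geometric-Y x b = by-multiple (t * x * r ^ b) uρ-inverse
    (solve 5 (λ t ρ u x w → let r = con (+ 1) :+ t :* ρ in
      t :* u :* ρ :* x :* w :+ t :* x :* w :* con (+ 1)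
      := t :* (x :* w :+ t :* u :* ρ :* x :* (r :* w)) :+ t :* x :* w :* (u :* ρ :* (con (+ 1) :- t :- t :^ 2 :* ρ)))
      ≋-refl t ρ u x (r ^ b))

module _ {X Y : ℕ → Series} where

  solve₂ : ∀ {c : ℕ → Series} {e} {C} x → (∀ b → c b ≋ C * r ^ b) →
    (∀ b → X b ≋ c b + t * (Y b + constant e * X b)) → (∀ b → Y b ≋ t * (X b + Y (suc b))) →
    x ≋ C + t * (t * u * ρ * x + constant e * x) →
    ∀ b → X b ≋ x * r ^ b × Y b ≋ t * u * ρ * x * r ^ b
  solve₂ {c} {e} {C} x c-eq X-eq Y-eq x-eq b = (pointwise λ n → proj₁ (agree n b)) , (pointwise λ n → proj₂ (agree n b))
    where
    X′-eq : ∀ b → x * r ^ b ≋ c b + t * (t * u * ρ * x * r ^ b + constant e * (x * r ^ b))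
    X′-eq b = by-multiple (r ^ b) x-eq (by-multiple (num 1) (≋-sym (c-eq b))
      (solve 8 (λ t ρ u x w c e C → let y = C :+ t :* (t :* u :* ρ :* x :+ e :* x) in
        x :* w :+ w :* y :+ con (+ 1) :* c := c :+ t :* (t :* u :* ρ :* x :* w :+ e :* (x :* w)) :+ w :* x :+ con (+ 1) :* (C :* w))
        ≋-refl t ρ u x (r ^ b) (c b) (constant e) C))
    agree = unique₂ {c = c} {e} X-eq Y-eq X′-eq (geometric-Y x)

module _ {P Y Z : ℕ → Series}
  (P-eq : ∀ b → P b ≋ u + t * (Y b + Z b)) (Y-eq : ∀ b → Y b ≋ t * (P b + Y (suc b)))
  (Z-zero : Z 0 ≋ 0ₛ) (Z-suc : ∀ b → Z (suc b) ≋ P b + Z b) where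

  private
    Z′ : ℕ → Series
    Z′ zero    = 0ₛ
    Z′ (suc b) = u * ρ * r ^ b + Z′ b

    t*Z′ : ∀ b → t * Z′ b + u ≋ u * r ^ b
    t*Z′ zero = solve 2 (λ t u → t :* con (+ 0) :+ u := u :* con (+ 1)) ≋-refl t u
    t*Z′ (suc b) = by-multiple (num 1) (t*Z′ b) (solve 5 (λ t u ρ w z →
        t :* (u :* ρ :* w :+ z) :+ u :+ con (+ 1) :* (u :* w) := u :* ((con (+ 1) :+ t :* ρ) :* w) :+ con (+ 1) :* (t :* z :+ u))
       ≋-refl t u ρ (r ^ b) (Z′ b))

    P′-eq : ∀ b → u * ρ * r ^ b ≋ u + t * (t * u * ρ * (u * ρ) * r ^ b + Z′ b)
    P′-eq b = by-multiple (u * r ^ b) uρ-inverse (by-multiple (u * ρ * r ^ b) (≋-sym u-inverse) (by-multiple (num 1) (≋-sym (t*Z′ b))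
      (solve 5 (λ t u ρ w z → let a = con (+ 1) :- t in
        u :* ρ :* w :+ u :* w :* con (+ 1) :+ u :* ρ :* w :* (u :* a) :+ con (+ 1) :* (t :* z :+ u)
        := u :+ t :* (t :* u :* ρ :* (u :* ρ) :* w :+ z) :+ u :* w :* (u :* ρ :* (a :- t :^ 2 :* ρ)) :+ u :* ρ :* w :* con (+ 1) :+ con (+ 1) :* (u :* w))
        ≋-refl t u ρ (r ^ b) (Z′ b))))

    agree : ∀ n b → P b n ≡ (u * ρ * r ^ b) n × Y b n ≡ (t * u * ρ * (u * ρ) * r ^ b) n
    agree = unique₁ {Z′ = Z′} {u} P-eq Y-eq Z-zero Z-suc P′-eq (geometric-Y (u * ρ)) ≋-refl (λ _ → ≋-refl)

  -- Subtracting consecutive equations eliminates Z: P (b + 1) - P b = t (Y (b + 1) - Y b + P b).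
  -- For P b = x rᵇ with r = 1 + t ρ this is precisely the quadratic equation of ρ, and the case b =
  -- 0 then gives x = u ρ.
  solve₁ : ∀ b → P b ≋ u * ρ * r ^ b
  solve₁ b = pointwise λ n → proj₁ (agree n b)

  u+t*Z : ∀ b → u + t * Z b ≋ u * r ^ b
  u+t*Z b = ≋-trans (+-congˡ {u} (*-congˡ {t} (Z≋Z′ b))) (≋-trans (CommutativeRing.+-comm seriesRing u (t * Z′ b)) (t*Z′ b))
    where
    Z≋Z′ : ∀ b → Z b ≋ Z′ b
    Z≋Z′ zero    = Z-zero
    Z≋Z′ (suc b) = ≋-trans (Z-suc b) (+-cong (solve₁ b) (Z≋Z′ b))

-- The series of the states

gf : (ℕ → ℕ) → Series
gf = generatingFunction

gf-+ : ∀ f g → gf (λ n → f n ℕ.+ g n) ≋ gf f + gf g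
at (gf-+ f g) n = fromℤ-+ (+ f n) (+ g n)

gf-zero : gf (λ _ → 0) ≋ 0ₛ
at gf-zero zero    = refl
at gf-zero (suc _) = refl

gf-suc : ∀ {f} g → f 0 ≡ 1 → (∀ n → f (suc n) ≡ g n) → gf f ≋ num 1 + t * gf g
at (gf-suc g f₀ f₊) zero    = trans (cong (λ x → fromℤ (+ x)) f₀) (sym (trans (cong (1ℚ ℚ.+_) (t*-zero (gf g))) (ℚ.+-identityʳ 1ℚ)))
at (gf-suc g f₀ f₊) (suc n) = trans (cong (λ x → fromℤ (+ x)) (f₊ n)) (sym (trans (ℚ.+-identityˡ _) (t*-suc (gf g) n)))

hat-gf-+ : ∀ (f g : ℕ → ℕ → ℕ) → hat (λ a → gf (λ n → f a n ℕ.+ g a n)) ≋ hat (gf ∘ f) + hat (gf ∘ g)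
hat-gf-+ f g = ≋-trans (hat-cong (λ a → gf-+ (f a) (g a))) (hat-+ (gf ∘ f) (gf ∘ g))

hat-gf-suc : ∀ {f} (g : ℕ → ℕ → ℕ) → (∀ a → f a 0 ≡ 1) → (∀ a n → f a (suc n) ≡ g a n) → hat (gf ∘ f) ≋ u + t * hat (gf ∘ g)
hat-gf-suc g f₀ f₊ = ≋-trans (hat-cong (λ a → gf-suc (g a) (f₀ a) (f₊ a)))
  (≋-trans (hat-+ (λ _ → num 1) (λ a → t * gf (g a))) (+-cong (hat-cong (≋-sym ∘ 1^)) (hat-* t (gf ∘ g))))
  where
  1^ : ∀ a → num 1 ^ a ≋ num 1
  1^ zero    = ≋-refl {num 1}
  1^ (suc a) = ≋-trans (*-congˡ {num 1} (1^ a)) (pointwise (1*ₛ (num 1)))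

hat-gf-zero : hat (λ _ → gf (λ _ → 0)) ≋ 0ₛ
hat-gf-zero = ≋-trans (hat-cong {G = λ _ → 0ₛ * num 1} (λ _ → ≋-trans gf-zero (solve 0 (con (+ 0) := con (+ 0) :* con (+ 1)) ≋-refl)))
  (≋-trans (hat-* 0ₛ (λ _ → num 1)) (solve 1 (λ f → con (+ 0) :* f := con (+ 0)) ≋-refl (hat (λ _ → num 1))))

X Y : Kind → ℕ → Series
X k b = hat (λ a → gf (F k a b))
Y k b = hat (λ a → gf (λ n → sumLow (λ i j → F k i j n) a b))

Z : ℕ → Series
Z b = hat (λ a → gf (λ n → sumBelow b (λ i → F none a i n)))

X? : Maybe Kind → ℕ → Series
X? k? b = maybe′ (λ k → X k b) 0ₛ k?

X-eq : ∀ k b → X k b ≋ u + t * (Y (low k) b + Z b + (X? (afterₘ k) b + X? (afterₙ k) b))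
X-eq k b = ≋-trans (hat-gf-suc (λ a n → lows a n ℕ.+ ups a n ℕ.+ (tops (afterₘ k) a n ℕ.+ tops (afterₙ k) a n)) (λ _ → refl) (λ _ _ → refl))
  (+-congˡ {u} (*-congˡ {t} (≋-trans (hat-gf-+ (λ a n → lows a n ℕ.+ ups a n) (λ a n → tops (afterₘ k) a n ℕ.+ tops (afterₙ k) a n))
    (+-cong (hat-gf-+ lows ups) (≋-trans (hat-gf-+ (tops (afterₘ k)) (tops (afterₙ k))) (+-cong (hat-tops (afterₘ k)) (hat-tops (afterₙ k))))))))
  where
  lows ups : ℕ → ℕ → ℕ
  lows a n = sumLow (λ i j → F (low k) i j n) a b
  ups  a n = sumBelow b (λ i → F none a i n)
  tops : Maybe Kind → ℕ → ℕ → ℕ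
  tops k? a n = maybe′ (λ k′ → F k′ a b n) 0 k?
  hat-tops : ∀ k? → hat (gf ∘ tops k?) ≋ X? k? b
  hat-tops nothing  = hat-gf-zero
  hat-tops (just k) = ≋-refl {X k b}

Y-eq : ∀ k b → Y k b ≋ t * (X k b + Y k (suc b))
Y-eq k b = ≋-trans (hat-unfold (λ a → gf (λ n → sumLow (λ i j → F k i j n) a b))) (≋-trans
  (+-cong gf-zero (*-congˡ {t} (hat-gf-+ (λ a n → F k a b n) (λ a n → sumLow (λ i j → F k i j n) a (suc b)))))
  (CommutativeRing.+-identityˡ seriesRing _))

Z-suc : ∀ b → Z (suc b) ≋ X none b + Z b
Z-suc b = hat-gf-+ (λ a n → F none a b n) (λ a n → sumBelow b (λ i → F none a i n))

private
  drop₀ : ∀ y z → u + t * (y + z + (0ₛ + 0ₛ)) ≋ u + t * (y + z)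
  drop₀ y z = solve 4 (λ t u y z → u :+ t :* (y :+ z :+ (con (+ 0) :+ con (+ 0))) := u :+ t :* (y :+ z)) ≋-refl t u y z

  none-eq : ∀ b → X none b ≋ u + t * (Y none b + Z b)
  none-eq b = ≋-trans (X-eq none b) (drop₀ (Y none b) (Z b))

X-none : ∀ b → X none b ≋ u * ρ * r ^ b
X-none = solve₁ none-eq (Y-eq none) hat-gf-zero Z-suc

u+tZ : ∀ b → u + t * Z b ≋ u * r ^ b
u+tZ = u+t*Z none-eq (Y-eq none) hat-gf-zero Z-suc

-- The loop yields x = u y / (1 - t - t² u ρ). By the quadratic equation (1 - t - t² u ρ) ρ = 1 - t
-- ρ, whence the factor ρ v.
X-loop : ∀ {k} c → (∀ b → X k b ≋ c b + t * (Y k b + num 1 * X k b)) → ∀ y → (∀ b → c b ≋ u * y * r ^ b) →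
         ∀ b → X k b ≋ u * ρ * v * y * r ^ b × Y k b ≋ t * u * ρ * (u * ρ * v * y) * r ^ b
X-loop {k} c X-eq′ y c-eq = solve₂ {c = c} {1ℚ} {u * y} (u * ρ * v * y) c-eq X-eq′ (Y-eq k)
  (by-multiple (u * u * v * y) (≋-sym ρ-quadratic) (by-multiple (u * v * (num 1 - ρ) * y) u-inverse (by-multiple (u * y) v-inverse
    (solve 5 (λ t ρ u v y → let a = con (+ 1) :- t; x = u :* ρ :* v :* y in
      x :+ u :* u :* v :* y :* (t :^ 2 :* ρ :^ 2 :+ a) :+ u :* v :* (con (+ 1) :- ρ) :* y :* con (+ 1) :+ u :* y :* con (+ 1)
      := u :* y :+ t :* (t :* u :* ρ :* x :+ con (+ 1) :* x) :+ u :* u :* v :* y :* (a :* ρ)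
         :+ u :* v :* (con (+ 1) :- ρ) :* y :* (u :* a) :+ u :* y :* ((con (+ 1) :- t :* ρ) :* v)) ≋-refl t ρ u v y))))

onlyₘ-closed : ∀ b → X onlyₘ b ≋ u * ρ * v * num 1 * r ^ b × Y onlyₘ b ≋ t * u * ρ * (u * ρ * v * num 1) * r ^ b
onlyₘ-closed = X-loop (λ b → u + t * Z b)
  (λ b → ≋-trans (X-eq onlyₘ b) (solve 5 (λ t u y z x → u :+ t :* (y :+ z :+ (x :+ con (+ 0))) := u :+ t :* z :+ t :* (y :+ con (+ 1) :* x)) ≋-refl t u (Y onlyₘ b) (Z b) (X onlyₘ b)))
  (num 1) (λ b → ≋-trans (u+tZ b) (solve 2 (λ u w → u :* w := u :* con (+ 1) :* w) ≋-refl u (r ^ b)))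

onlyₙ-closed : ∀ b → X onlyₙ b ≋ u * ρ * v * num 1 * r ^ b × Y onlyₙ b ≋ t * u * ρ * (u * ρ * v * num 1) * r ^ b
onlyₙ-closed = X-loop (λ b → u + t * Z b)
  (λ b → ≋-trans (X-eq onlyₙ b) (solve 5 (λ t u y z x → u :+ t :* (y :+ z :+ (con (+ 0) :+ x)) := u :+ t :* z :+ t :* (y :+ con (+ 1) :* x)) ≋-refl t u (Y onlyₙ b) (Z b) (X onlyₙ b)))
  (num 1) (λ b → ≋-trans (u+tZ b) (solve 2 (λ u w → u :* w := u :* con (+ 1) :* w) ≋-refl u (r ^ b)))

once-closed : ∀ b → X once b ≋ u * ρ * v * r * r ^ b × Y once b ≋ t * u * ρ * (u * ρ * v * r) * r ^ b
once-closed = X-loop (λ b → u + t * Z b + t * X none b)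
  (λ b → ≋-trans (X-eq once b) (solve 6 (λ t u y z x x′ → u :+ t :* (y :+ z :+ (x′ :+ x)) := u :+ t :* z :+ t :* x′ :+ t :* (y :+ con (+ 1) :* x)) ≋-refl t u (Y once b) (Z b) (X once b) (X none b)))
  r (λ b → ≋-trans (+-cong (u+tZ b) (*-congˡ {t} (X-none b))) (solve 4 (λ t u ρ w → u :* w :+ t :* (u :* ρ :* w) := u :* (con (+ 1) :+ t :* ρ) :* w) ≋-refl t u ρ (r ^ b)))

-- Here there is no loop, and the reciprocal of 1 - t² u ρ is ρ. The factor t + ρ is 1 + t ρ + t²
-- ρ², simplified by the quadratic equation.
both-closed : ∀ b → X both b ≋ u * ρ * v * (t + ρ) * r ^ b × Y both b ≋ t * u * ρ * (u * ρ * v * (t + ρ)) * r ^ b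
both-closed = solve₂ {c = λ b → u + t * Z b + t * (X onlyₘ b + X once b)} {0ℚ} {u + t * (u * ρ * v * num 1 + u * ρ * v * r)} (u * ρ * v * (t + ρ))
  (λ b → ≋-trans (+-cong (u+tZ b) (*-congˡ {t} (+-cong (proj₁ (onlyₘ-closed b)) (proj₁ (once-closed b)))))
    (solve 5 (λ t u x x′ w → u :* w :+ t :* (x :* w :+ x′ :* w) := (u :+ t :* (x :+ x′)) :* w) ≋-refl t u (u * ρ * v * num 1) (u * ρ * v * r) (r ^ b)))
  (λ b → ≋-trans (X-eq both b) (solve 6 (λ t u y z x x′ → u :+ t :* (y :+ z :+ x′) := u :+ t :* z :+ t :* x′ :+ t :* (y :+ con (+ 0) :* x)) ≋-refl t u (Y both b) (Z b) (X both b) (X onlyₘ b + X once b)))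
  (Y-eq both)
  (by-multiple (u * u * v * (t + ρ) + u * v) (≋-sym ρ-quadratic) (by-multiple (u * v * (num 1 - ρ) * (t + ρ)) u-inverse (by-multiple u v-inverse
    (solve 4 (λ t ρ u v → let a = con (+ 1) :- t; r = con (+ 1) :+ t :* ρ; y = t :+ ρ; x = u :* ρ :* v :* y in
      x :+ (u :* u :* v :* y :+ u :* v) :* (t :^ 2 :* ρ :^ 2 :+ a) :+ u :* v :* (con (+ 1) :- ρ) :* y :* con (+ 1) :+ u :* con (+ 1)
      := u :+ t :* (u :* ρ :* v :* con (+ 1) :+ u :* ρ :* v :* r) :+ t :* (t :* u :* ρ :* x :+ con (+ 0) :* x) :+ (u :* u :* v :* y :+ u :* v) :* (a :* ρ)
         :+ u :* v :* (con (+ 1) :- ρ) :* y :* (u :* a) :+ u :* ((con (+ 1) :- t :* ρ) :* v)) ≋-refl t ρ u v))))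

-- Elimination of the auxiliary series

d j : Series
d = num 1 - num 3 * t + t ^ 2
j = t * (num 1 - (num 1 - t) * ρ)

-- The product of 1 - t ρ with its conjugate under the quadratic equation is - d / t, which is where
-- 1 - 3 t + t² comes from. Hence d v = 1 - 2 t - t² ρ, and multiplying by ρ - 1 leaves j, again
-- linear in ρ.
dv-reduced : d * ((ρ - num 1) * v) ≋ j
dv-reduced = by-multiple ((ρ - num 1) * (num 1 - num 2 * t - t ^ 2 * ρ)) v-inverse
  (by-multiple (num 1 + t * (ρ - num 1) * v) (≋-sym ρ-quadratic)
    (solve 3 (λ t ρ v → let one = con (+ 1); a = one :- t; s = ρ :- one; e = con (+ 1) :- con (+ 2) :* t :- t :^ 2 :* ρ in
      (one :- con (+ 3) :* t :+ t :^ 2) :* (s :* v) :+ s :* e :* one :+ (one :+ t :* s :* v) :* (t :^ 2 :* ρ :^ 2 :+ a)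
      := t :* (one :- a :* ρ) :+ s :* e :* ((one :- t :* ρ) :* v) :+ (one :+ t :* s :* v) :* (a :* ρ)) ≋-refl t ρ v))

-- By the quadratic equation t² u ρ² = ρ - 1, so (1 - t) t Y collapses to (ρ - 1) v y.
Y-reduced : ∀ {k} y → Y k 0 ≋ t * u * ρ * (u * ρ * v * y) * r ^ 0 → d * ((num 1 - t) * (t * Y k 0)) ≋ j * y
Y-reduced {k} y Y-closed = by-multiple (d * (num 1 - t) * t) Y-closed (by-multiple y dv-reduced
  (by-multiple (d * (t ^ 2 * u * ρ ^ 2 * v * y + (ρ - num 1) * v * y)) u-inverse (by-multiple (d * u * v * y) ρ-quadratic
    (solve 8 (λ t ρ u v y d j Y → let one = con (+ 1); a = one :- t; s = ρ :- one; m = d :* (t :^ 2 :* u :* ρ :^ 2 :* v :* y :+ s :* v :* y); n = d :* u :* v :* y in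
      d :* (a :* (t :* Y)) :+ d :* a :* t :* (t :* u :* ρ :* (u :* ρ :* v :* y) :* one) :+ y :* j :+ m :* one :+ n :* (a :* ρ)
      := j :* y :+ d :* a :* t :* Y :+ y :* (d :* (s :* v)) :+ m :* (u :* a) :+ n :* (t :^ 2 :* ρ :^ 2 :+ a))
     ≋-refl t ρ u v y d j (Y k 0)))))

private
  R Q M E a : Series
  R = X onlyₙ° 0
  Q = X once° 0
  M = X both° 0
  E = u + t * (Y both 0 + M)
  a = num 1 - t

  -- The kinds with ° occur at b = 0, where Z vanishes. Each of the three has a loop, which divides
  -- by 1 - t, and each draws on the one solved before it; so the powers of a rise from 2 to 4.
  R-reduced : d * (a ^ 2 * R) ≋ d + j
  R-reduced = by-multiple (d * a) (X-eq onlyₙ° 0) (by-multiple (d * a * t) (hat-gf-zero) (by-multiple (num 1) (Y-reduced (num 1) (proj₂ (onlyₙ-closed 0)))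
    (by-multiple d u-inverse
      (solve 7 (λ t u d j R Y Z → let one = con (+ 1); a = one :- t in
        d :* (a :^ 2 :* R) :+ d :* a :* (u :+ t :* (Y :+ Z :+ (con (+ 0) :+ R))) :+ d :* a :* t :* con (+ 0) :+ one :* (j :* one) :+ d :* one
        := d :+ j :+ d :* a :* R :+ d :* a :* t :* Z :+ one :* (d :* (a :* (t :* Y))) :+ d :* (u :* a)) ≋-refl t u d j R (Y onlyₙ 0) (Z 0)))))

  Q-reduced : d * (a ^ 3 * Q) ≋ d * a + t * (d + j) + a * (j * r)
  Q-reduced = by-multiple (d * a ^ 2) (X-eq once° 0) (by-multiple (d * a ^ 2 * t) (hat-gf-zero) (by-multiple a (Y-reduced r (proj₂ (once-closed 0)))
    (by-multiple (d * a) u-inverse (by-multiple t R-reduced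
      (solve 9 (λ t u d j R Y Z Q r → let one = con (+ 1); a = one :- t in
        d :* (a :^ 3 :* Q) :+ d :* a :^ 2 :* (u :+ t :* (Y :+ Z :+ (R :+ Q))) :+ d :* a :^ 2 :* t :* con (+ 0) :+ a :* (j :* r) :+ d :* a :* one :+ t :* (d :+ j)
        := d :* a :+ t :* (d :+ j) :+ a :* (j :* r) :+ d :* a :^ 2 :* Q :+ d :* a :^ 2 :* t :* Z :+ a :* (d :* (a :* (t :* Y))) :+ d :* a :* (u :* a) :+ t :* (d :* (a :^ 2 :* R)))
        ≋-refl t u d j R (Y once 0) (Z 0) Q r)))))

  E-reduced : d * (a ^ 4 * E) ≋ a ^ 2 * (d + j * (t + ρ)) + t ^ 2 * (d * a + t * (d + j) + a * (j * r))
  E-reduced = by-multiple (d * a ^ 3 * t) (X-eq both° 0) (by-multiple (d * a ^ 3 * t ^ 2) (hat-gf-zero) (by-multiple (a ^ 2) (Y-reduced (t + ρ) (proj₂ (both-closed 0)))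
    (by-multiple (d * a ^ 2) u-inverse (by-multiple (t ^ 2) Q-reduced
      (solve 10 (λ t u d j M Y Z Q ρ q → let one = con (+ 1); a = one :- t in
        d :* (a :^ 4 :* (u :+ t :* (Y :+ M))) :+ d :* a :^ 3 :* t :* (u :+ t :* (Y :+ Z :+ (M :+ Q))) :+ d :* a :^ 3 :* t :^ 2 :* con (+ 0) :+ a :^ 2 :* (j :* (t :+ ρ)) :+ d :* a :^ 2 :* one :+ t :^ 2 :* q
        := a :^ 2 :* (d :+ j :* (t :+ ρ)) :+ t :^ 2 :* q :+ d :* a :^ 3 :* t :* M :+ d :* a :^ 3 :* t :^ 2 :* Z :+ a :^ 2 :* (d :* (a :* (t :* Y))) :+ d :* a :^ 2 :* (u :* a) :+ t :^ 2 :* (d :* (a :^ 3 :* Q)))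
        ≋-refl t u d j M (Y both 0) (Z 0) Q ρ (d * a + t * (d + j) + a * (j * r)))))))

cleared-equation : ∀ {G} → G ≋ num 1 + t * (u + t * (Y both 0 + X both° 0)) →
       num 2 * t ^ 2 * (num 1 - t) ^ 2 * (num 1 - num 3 * t + t ^ 2) * G
         + (num 1 - num 3 * t - num 2 * t ^ 2 + num 14 * t ^ 3 - num 15 * t ^ 4 + num 3 * t ^ 5)
       ≋ (num 1 - t ^ 2) * (num 1 - t) ^ 2 * √Δ
-- `E-reduced` involves the fourth power of 1 - t, two factors more than the claim, so two are
-- multiplied in and cancelled. The multiplier of `ρ-quadratic` is chosen to cancel the ρ² terms
-- coming from j (t + ρ) and j r; the rest is linear in ρ, and `t²ρ` trades it for √Δ.
cleared-equation {G} G-eq = *-cancel-unit {u} {a} u-inverse (*-cancel-unit {u} {a} u-inverse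
  (by-multiple (num 2 * t ^ 2 * a ^ 4 * d) G-eq (by-multiple (num 2 * t ^ 3) E-reduced
    (by-multiple ((num 1 - t ^ 2) * a ^ 4) (≋-sym t²ρ) (by-multiple (num 2 * t ^ 2 * a ^ 3 + num 2 * t ^ 5 * a ^ 2) (≋-sym ρ-quadratic)
      (solve 5 (λ t ρ G E s → let one = con (+ 1); two = con (+ 2); a = one :- t; d = one :- con (+ 3) :* t :+ t :^ 2; j = t :* (one :- a :* ρ)
                                  f = two :* t :^ 2 :* a :^ 2 :* d :* G :+ (one :- con (+ 3) :* t :- two :* t :^ 2 :+ con (+ 14) :* t :^ 3 :- con (+ 15) :* t :^ 4 :+ con (+ 3) :* t :^ 5)
                                  c₁ = two :* t :^ 2 :* a :^ 4 :* d; c₂ = two :* t :^ 3; c₃ = (one :- t :^ 2) :* a :^ 4; c₄ = two :* t :^ 2 :* a :^ 3 :+ two :* t :^ 5 :* a :^ 2 in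
        a :* (a :* f) :+ c₁ :* (one :+ t :* E) :+ c₂ :* (a :^ 2 :* (d :+ j :* (t :+ ρ)) :+ t :^ 2 :* (d :* a :+ t :* (d :+ j) :+ a :* (j :* (one :+ t :* ρ))))
          :+ c₃ :* (two :* t :^ 2 :* ρ) :+ c₄ :* (t :^ 2 :* ρ :^ 2 :+ a)
        := a :* (a :* ((one :- t :^ 2) :* a :^ 2 :* s)) :+ c₁ :* G :+ c₂ :* (d :* (a :^ 4 :* E)) :+ c₃ :* (one :- t :- s) :+ c₄ :* (a :* ρ))
        ≋-refl t ρ G E √Δ))))))


-- Beyond the first letter, a run of length a + 1 costs a letters. Its weight is thus the tᵃ of
-- `hat`, and only states with b = 0 enter after the first repetition.
p-series : gf (λ n → p n patterns) ≋ num 1 + t * (u + t * (Y both 0 + X both° 0))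
p-series = ≋-trans (gf-suc (initialRun 0) (completions-zero {M = 0} (Prefix.good (Distinct.prefix distinct-[]))) p-suc)
  (+-congˡ {num 1} (*-congˡ {t} (≋-trans (hat-unique {gf ∘ repeating} {gf ∘ initialRun} run)
    (≋-trans (hat-gf-suc firstRepeat (λ _ → refl) (λ _ _ → refl))
      (+-congˡ {u} (*-congˡ {t} (hat-gf-+ (λ a n → sumLow (λ i j → F both i j n) a 0) (λ a n → F both° a 0 n))))))))
  where
  repeating : ℕ → ℕ → ℕ
  repeating a zero    = 1
  repeating a (suc n) = firstRepeat a n
  run : ∀ a → gf (initialRun a) ≋ gf (repeating a) + t * gf (initialRun (suc a))
  at (run a) zero    = sym (trans (cong (1ℚ ℚ.+_) (t*-zero (gf (initialRun (suc a))))) (ℚ.+-identityʳ 1ℚ))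
  at (run a) (suc n) = trans (at (gf-+ (initialRun (suc a)) (firstRepeat a)) n)
    (trans (ℚ.+-comm (gf (initialRun (suc a)) n) (gf (firstRepeat a) n)) (cong (gf (firstRepeat a) n ℚ.+_) (sym (t*-suc (gf (initialRun (suc a))) n))))

clear-denominators : ∀ {G} →
  num 2 * t ^ 2 * (num 1 - t) ^ 2 * (num 1 - num 3 * t + t ^ 2) * G
    + (num 1 - num 3 * t - num 2 * t ^ 2 + num 14 * t ^ 3 - num 15 * t ^ 4 + num 3 * t ^ 5)
  ≋ (num 1 - t ^ 2) * (num 1 - t) ^ 2 * √Δ →
  G * (num 2 * t ^ 2 * (num 1 - num 3 * t + t ^ 2) * (num 2 * t ^ 2 * (num 1 - t) ^ 2 * (num 1 - num 3 * t + t ^ 2)))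
  ≋ ((num 1 - t ^ 2) * √Δ * (num 2 * t ^ 2 * (num 1 - t) ^ 2 * (num 1 - num 3 * t + t ^ 2))
      - (num 1 - num 3 * t - num 2 * t ^ 2 + num 14 * t ^ 3 - num 15 * t ^ 4 + num 3 * t ^ 5) * (num 2 * t ^ 2 * (num 1 - num 3 * t + t ^ 2))) * num 1
-- The cross-multiplied equation is the cleared one times 2 t² (1 - 3 t + t²), the common factor of
-- both denominators.
clear-denominators {G} eq = by-multiple (num 2 * t ^ 2 * (num 1 - num 3 * t + t ^ 2)) eq
  (solve 7 (λ k a d c q G s → G :* (k :* d :* (k :* a :* d)) :+ k :* d :* (c :* a :* s)
      := (c :* s :* (k :* a :* d) :- q :* (k :* d)) :* con (+ 1) :+ k :* d :* (k :* a :* d :* G :+ q)) ≋-refl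
    (num 2 * t ^ 2) ((num 1 - t) ^ 2) (num 1 - num 3 * t + t ^ 2) (num 1 - t ^ 2)
    (num 1 - num 3 * t - num 2 * t ^ 2 + num 14 * t ^ 3 - num 15 * t ^ 4 + num 3 * t ^ 5) G √Δ)

open import Defs using (fromNat)

theorem4p22 : ↑ (generatingFunction (λ n → p n ((1 ∷ 1 ∷ 2 ∷ 3 ∷ []) ∷ (1 ∷ 2 ∷ 1 ∷ 1 ∷ []) ∷ [])))
    ≈ (1 - t ^ 2) * √ ((1 - t) * (1 - t - 4 * t ^ 2)) / (2 * t ^ 2 * (1 - 3 * t + t ^ 2))
    ⊖ (1 - 3 * t - 2 * t ^ 2 + 14 * t ^ 3 - 15 * t ^ 4 + 3 * t ^ 5) / (2 * t ^ 2 * (1 - t) ^ 2 * (1 - 3 * t + t ^ 2))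
theorem4p22 = at (clear-denominators {gf (λ n → p n patterns)} (cleared-equation p-series))
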